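{- Let $p=2$. There is a constant $\alpha>0$, not depending on $N$, such that for all sufficiently large $N$ and every polynomial $g\in\mathbb{F}_2[x_1,\dots,x_N]$ of degree at most $3$, $$|\langle S_4,g\rangle|<\exp\{ -\alpha N\}.$$
   Context: $S_4(x)=\sum_{S\subseteq[N],|S|=4}\prod_{i\in S}x_i$ is the elementary symmetric polynomial of degree $4$ in $N$ variables over $\mathbb{F}_2$. For functions $f,g:\mathbb{F}_2^N\to\mathbb{F}_2$, $\langle f,g\rangle=\mathbb{E}_{x\in\mathbb{F}_2^N}(-1)^{f(x)-g(x)}$. -}

module Defs where

open import Data.Bool using (Bool; true; false; _∧_; _xor_)
open import Data.Nat using (ℕ; zero; suc; _≤_)
open import Data.Fin using (Fin)
open import Data.Vec using (Vec; []; _∷_; lookup)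
open import Data.List using (List; []; _∷_; _++_; map; foldr; length)
open import Data.List.Relation.Unary.All using (All)
open import Data.Integer using (ℤ; +_; -_; _+_)

-- Elements of F₂ are represented by Bool (true = 1); addition is xor, product is ∧.

-- Elementary symmetric polynomial of degree k over F₂, evaluated at a point,
-- via the standard recursion e_{k+1}(x, xs) = e_{k+1}(xs) + x · e_k(xs),
-- which is exactly the sum over k-subsets of the product of the chosen coordinates.
elemSym : ℕ → {n : ℕ} → Vec Bool n → Bool
elemSym zero    _        = true
elemSym (suc k) []       = false
elemSym (suc k) (x ∷ xs) = elemSym (suc k) xs xor (x ∧ elemSym k xs)

S4 : {N : ℕ} → Vec Bool N → Bool
S4 = elemSym 4

-- A monomial in x₁..x_N is a list of variables (repetitions allowed);
-- its degree is its length.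
Monomial : ℕ → Set
Monomial N = List (Fin N)

evalMono : {N : ℕ} → Monomial N → Vec Bool N → Bool
evalMono m x = foldr (λ i b → lookup x i ∧ b) true m

-- A polynomial over F₂ is a (formal) F₂-sum of monomials.
Poly : ℕ → Set
Poly N = List (Monomial N)

evalPoly : {N : ℕ} → Poly N → Vec Bool N → Bool
evalPoly g x = foldr (λ m b → evalMono m x xor b) false g

DegreeAtMost : {N : ℕ} → ℕ → Poly N → Set
DegreeAtMost d g = All (λ m → length m ≤ d) g

allPoints : (n : ℕ) → List (Vec Bool n)
allPoints zero    = [] ∷ []
allPoints (suc n) = map (false ∷_) (allPoints n) ++ map (true ∷_) (allPoints n)

sumℤ : List ℤ → ℤ
sumℤ = foldr _+_ (+ 0)

sign : Bool → ℤ
sign false = + 1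
sign true  = - (+ 1)

-- 2^N · ⟨f,g⟩ = Σ_{x ∈ F₂^N} (-1)^{f(x) - g(x)}
corrSum : {N : ℕ} → (Vec Bool N → Bool) → (Vec Bool N → Bool) → ℤ
corrSum {N} f g = sumℤ (map (λ x → sign (f x xor g x)) (allPoints N))

{-# OPTIONS --safe #-}

-- Let ω be a primitive eighth root of unity. The sign (-1)^S₄(x) is the sum, up to signs, of the
-- coordinates of ω^|x| in the basis 1, ω, ω², ω³ of ℤ[ω], so two applications of Cauchy–Schwarz to
-- Σ ω^|x| (-1)^g(x) bound the fourth power of the correlation by the number of pairs (h, k) with
-- Φ(h, k, -) = 0, where Φ(h, k, l) = Σ hᵢkᵢlᵢ + DₗDₖDₕg is symmetric and trilinear since g is cubic.
-- Because D²= 0 in characteristic 2, the symmetric matrix M_h = Φ(h, -, -) has diagonal h. Modulo 2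
-- its principal minor on a set A of indices is Π_{i ∈ A} hᵢ plus a polynomial in h of degree less
-- than |A|. Hence, on the set of h for which all principal minors of order d vanish, every function is
-- a polynomial of degree less than d, so this set has at most Σ_{i < d} C(N, i) elements; for every
-- other h the kernel of M_h has codimension at least d. Taking d = N / 4 gives an exponential saving.
module Submission where

open import Defs
open import Data.Bool using (Bool; true; false; _∧_; _xor_; not; if_then_else_)
import Data.Bool.Properties as Bool
open import Data.Bool.Properties using (xor-comm; xor-assoc; xor-same; xor-identityˡ; xor-identityʳ;
  ∧-distribˡ-xor; ∧-distribʳ-xor; ∧-zeroʳ; ∧-identityʳ; ∧-comm; ∧-assoc; ¬-not)
open import Data.Bool.Solver using (module xor-∧-Solver)
open import Data.Fin using (Fin; zero; suc)
open import Data.Fin.Properties using (any?)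
import Data.List as List
open import Data.List using (length)
import Data.List.Properties as List
open import Data.List.Relation.Unary.All as All using (All; []; _∷_)
import Data.List.Relation.Unary.All.Properties as All
open import Data.Nat as ℕ using (ℕ; zero; suc)
import Data.Nat.DivMod as ℕ
import Data.Nat.Properties as ℕₚ
import Data.Nat.Tactic.RingSolver as ℕ-Ring
open import Data.Product using (_×_; _,_; ∃-syntax; proj₁; proj₂)
open import Data.Sum using (_⊎_; inj₁; inj₂)
open import Data.Unit using (⊤; tt)
open import Data.Vec as Vec using (Vec; []; _∷_; _++_; lookup; zipWith; replicate; tail; toList; take; drop; zip)
open import Data.Vec.Membership.Propositional using (_∈_)
open import Data.Vec.Properties using (zipWith-comm; zipWith-assoc; zipWith-identityˡ; zipWith-identityʳ;
  lookup-zipWith; ++-injectiveˡ; ++-injectiveʳ; take++drop≡id; map-proj₁-zip; ≡-dec)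
open import Data.Vec.Relation.Unary.Any using (Any; here; there)
open import Function using (_∘_)
open import Relation.Binary.PropositionalEquality
open import Relation.Nullary using (¬_; contradiction; yes; no; Dec; does; ⌊_⌋)
open import Relation.Nullary.Decidable using (map′; dec-true)

-- S₄ has degree 4, but ω^|x|, the phase of |x| / 8, has degree 3. Hence two differences, not three,
-- leave a sign that is affine in x, and its sum over x is 0 or ± 2^N. The price is that ω^|x| does
-- correlate with S₄, so the argument must tell classical cubics from this phase; it does so through
-- the diagonal of M_h.
--
-- The density of the bad pairs (h, k) is at most the density of the exceptional h plus 2^-d. The
-- first is exponentially small as long as d / N stays below a constant less than 1/2, the second as
-- long as d grows linearly in N; d = N / 4 serves both.
--
-- The ring ℤ[ω] is never formed: the function `κ` on exponents records one coordinate, and the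
-- others are its shifts. The correlation stays multiplied by 2^N, all inequalities are cleared of
-- denominators, and exp(-αN) takes the form (p / q)^N with α = log (q / p).

infixl 6 _⊕_
_⊕_ : ∀ {n} → Vec Bool n → Vec Bool n → Vec Bool n
_⊕_ = zipWith _xor_

𝟎 : ∀ {n} → Vec Bool n
𝟎 = replicate _ false

e : ∀ {n} → Fin n → Vec Bool n
e zero    = true ∷ 𝟎
e (suc i) = false ∷ e i

⊕-comm : ∀ {n} (x y : Vec Bool n) → x ⊕ y ≡ y ⊕ x
⊕-comm = zipWith-comm xor-comm

⊕-assoc : ∀ {n} (x y z : Vec Bool n) → x ⊕ y ⊕ z ≡ x ⊕ (y ⊕ z)
⊕-assoc = zipWith-assoc xor-assoc

⊕-identityˡ : ∀ {n} (x : Vec Bool n) → 𝟎 ⊕ x ≡ x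
⊕-identityˡ = zipWith-identityˡ xor-identityˡ

⊕-identityʳ : ∀ {n} (x : Vec Bool n) → x ⊕ 𝟎 ≡ x
⊕-identityʳ = zipWith-identityʳ xor-identityʳ

⊕-self : ∀ {n} (x : Vec Bool n) → x ⊕ x ≡ 𝟎
⊕-self []      = refl
⊕-self (b ∷ x) = cong₂ _∷_ (xor-same b) (⊕-self x)

⊕-cancelˡ : ∀ {n} (x y : Vec Bool n) → x ⊕ (x ⊕ y) ≡ y
⊕-cancelˡ x y = trans (sym (⊕-assoc x x y)) (trans (cong (_⊕ y) (⊕-self x)) (⊕-identityˡ y))

⊕-swapʳ : ∀ {n} (x y z : Vec Bool n) → x ⊕ y ⊕ z ≡ x ⊕ z ⊕ y
⊕-swapʳ x y z = trans (⊕-assoc x y z) (trans (cong (x ⊕_) (⊕-comm y z)) (sym (⊕-assoc x z y)))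

infixl 7 _⊙_
_⊙_ : ∀ {n} → Vec Bool n → Vec Bool n → Vec Bool n
_⊙_ = zipWith _∧_

wt : ∀ {n} → Vec Bool n → ℕ
wt []          = 0
wt (false ∷ x) = wt x
wt (true ∷ x)  = suc (wt x)

parity : ∀ {n} → Vec Bool n → Bool
parity []      = false
parity (b ∷ x) = b xor parity x

wt-⊕ : ∀ {n} (x h : Vec Bool n) → wt x ℕ.+ wt h ≡ wt (x ⊕ h) ℕ.+ 2 ℕ.* wt (x ⊙ h)
wt-⊕ []          []          = refl
wt-⊕ (false ∷ x) (false ∷ h) = wt-⊕ x h
wt-⊕ (true ∷ x)  (false ∷ h) = cong suc (wt-⊕ x h)
wt-⊕ (false ∷ x) (true ∷ h)  = trans (ℕₚ.+-suc (wt x) (wt h)) (cong suc (wt-⊕ x h))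
wt-⊕ (true ∷ x)  (true ∷ h)  = trans (cong suc (trans (ℕₚ.+-suc (wt x) (wt h)) (cong suc (wt-⊕ x h))))
                                     (lemma (wt (x ⊕ h)) (wt (x ⊙ h)))
  where
  lemma : ∀ s t → 2 ℕ.+ (s ℕ.+ 2 ℕ.* t) ≡ s ℕ.+ 2 ℕ.* suc t
  lemma = ℕ-Ring.solve-∀

⊙-distribʳ-⊕ : ∀ {n} (x y h : Vec Bool n) → (x ⊕ y) ⊙ h ≡ x ⊙ h ⊕ y ⊙ h
⊙-distribʳ-⊕ []      []      []      = refl
⊙-distribʳ-⊕ (a ∷ x) (b ∷ y) (c ∷ h) = cong₂ _∷_ (∧-distribʳ a b c) (⊙-distribʳ-⊕ x y h)
  where
  ∧-distribʳ : ∀ a b c → (a xor b) ∧ c ≡ (a ∧ c) xor (b ∧ c)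
  ∧-distribʳ false b     c = refl
  ∧-distribʳ true  false c = sym (xor-identityʳ c)
  ∧-distribʳ true  true  c = sym (xor-same c)

⊙-common : ∀ {n} (x y h : Vec Bool n) → (x ⊙ h) ⊙ (y ⊙ h) ≡ x ⊙ (h ⊙ y)
⊙-common []          []          []          = refl
⊙-common (false ∷ x) (b ∷ y)     (c ∷ h)     = cong (false ∷_) (⊙-common x y h)
⊙-common (true ∷ x)  (b ∷ y)     (false ∷ h) = cong (false ∷_) (⊙-common x y h)
⊙-common (true ∷ x)  (false ∷ y) (true ∷ h)  = cong (false ∷_) (⊙-common x y h)
⊙-common (true ∷ x)  (true ∷ y)  (true ∷ h)  = cong (true ∷_) (⊙-common x y h)

xor-interchange : ∀ a b c d → (a xor b) xor (c xor d) ≡ (a xor c) xor (b xor d)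
xor-interchange a b c d = begin
  (a xor b) xor (c xor d)   ≡⟨ xor-assoc a b (c xor d) ⟩
  a xor (b xor (c xor d))   ≡⟨ cong (a xor_) (trans (sym (xor-assoc b c d)) (trans (cong (_xor d) (xor-comm b c)) (xor-assoc c b d))) ⟩
  a xor (c xor (b xor d))   ≡⟨ xor-assoc a c (b xor d) ⟨
  (a xor c) xor (b xor d)   ∎
  where open ≡-Reasoning

xor-cancelˡ : ∀ a b → a xor (a xor b) ≡ b
xor-cancelˡ a b = trans (sym (xor-assoc a a b)) (cong (_xor b) (xor-same a))

xor-telescope : ∀ a b c → (a xor b) xor (b xor c) ≡ a xor c
xor-telescope a b c = trans (xor-assoc a b (b xor c)) (cong (a xor_) (xor-cancelˡ b c))

D : ∀ {n} → Vec Bool n → (Vec Bool n → Bool) → Vec Bool n → Bool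
D h f x = f x xor f (x ⊕ h)

-- The sign left when ω^|x| (-1)^g(x) is differenced along h and then along k. By `wt-⊕`, |x| - |x ⊕
-- h| = 2|x ⊙ h| - |h|; a second difference gives 4|x ⊙ h ⊙ k| - 2|k ⊙ h|, and ω⁴ = -1 turns its
-- first term into a parity.
phase : ∀ {n} → (Vec Bool n → Bool) → Vec Bool n → Vec Bool n → Vec Bool n → Bool
phase g h k x = D k (D h g) x xor parity (x ⊙ (h ⊙ k))

indicator : Bool → ℕ
indicator b = if b then 1 else 0

-- The recursion halves the cube, so that `extend` can split a vector of length `count S` between
-- the two halves.
count : ∀ {n} → (Vec Bool n → Bool) → ℕ
count {zero}  S = indicator (S [])
count {suc n} S = count (S ∘ (false ∷_)) ℕ.+ count (S ∘ (true ∷_))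

-- Integer sums over the cube

module CubeSums where
  open import Data.Integer using (ℤ; +_; -[1+_]; +≤+; -_; _+_; _*_; _≤_; 0ℤ; 1ℤ; drop‿+≤+)
  open import Data.Integer.Properties
  open import Data.Integer.Tactic.RingSolver using (solve-∀)

  ∑ : ∀ {n} → (Vec Bool n → ℤ) → ℤ
  ∑ {zero}  f = f []
  ∑ {suc n} f = ∑ (f ∘ (false ∷_)) + ∑ (f ∘ (true ∷_))

  corrSum≡∑ : ∀ {N} (f g : Vec Bool N → Bool) → corrSum f g ≡ ∑ (λ x → sign (f x xor g x))
  corrSum≡∑ {N} f g = sumℤ-allPoints N _
    where
    sumℤ-++ : ∀ xs ys → sumℤ (xs List.++ ys) ≡ sumℤ xs + sumℤ ys
    sumℤ-++ List.[]       ys = sym (+-identityˡ _)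
    sumℤ-++ (x List.∷ xs) ys = trans (cong (λ s → x + s) (sumℤ-++ xs ys)) (sym (+-assoc x (sumℤ xs) (sumℤ ys)))

    sumℤ-allPoints : ∀ n (h : Vec Bool n → ℤ) → sumℤ (List.map h (allPoints n)) ≡ ∑ h
    sumℤ-allPoints zero    h = +-identityʳ (h [])
    sumℤ-allPoints (suc n) h = begin
      sumℤ (List.map h (xs₀ List.++ xs₁))
        ≡⟨ cong sumℤ (List.map-++ h xs₀ xs₁) ⟩
      sumℤ (List.map h xs₀ List.++ List.map h xs₁)
        ≡⟨ sumℤ-++ (List.map h xs₀) (List.map h xs₁) ⟩
      sumℤ (List.map h xs₀) + sumℤ (List.map h xs₁)
        ≡⟨ cong₂ _+_ (half false) (half true) ⟩
      ∑ h ∎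
      where
      open ≡-Reasoning
      xs₀ = List.map (false ∷_) (allPoints n)
      xs₁ = List.map (true ∷_) (allPoints n)
      half : ∀ b → sumℤ (List.map h (List.map (b ∷_) (allPoints n))) ≡ ∑ (h ∘ (b ∷_))
      half b = trans (cong sumℤ (sym (List.map-∘ (allPoints n)))) (sumℤ-allPoints n (h ∘ (b ∷_)))

  ∑-cong : ∀ {n} {f g : Vec Bool n → ℤ} → (∀ x → f x ≡ g x) → ∑ f ≡ ∑ g
  ∑-cong {zero}  eq = eq []
  ∑-cong {suc n} eq = cong₂ _+_ (∑-cong (eq ∘ (false ∷_))) (∑-cong (eq ∘ (true ∷_)))

  ∑-+ : ∀ {n} (f g : Vec Bool n → ℤ) → ∑ (λ x → f x + g x) ≡ ∑ f + ∑ g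
  ∑-+ {zero}  f g = refl
  ∑-+ {suc n} f g = trans
    (cong₂ _+_ (∑-+ (f ∘ (false ∷_)) (g ∘ (false ∷_))) (∑-+ (f ∘ (true ∷_)) (g ∘ (true ∷_))))
    (interchange (∑ (f ∘ (false ∷_))) _ _ _)
    where
    interchange : ∀ a b c d → (a + b) + (c + d) ≡ (a + c) + (b + d)
    interchange = solve-∀

  ∑-*ˡ : ∀ {n} c (f : Vec Bool n → ℤ) → ∑ (λ x → c * f x) ≡ c * ∑ f
  ∑-*ˡ {zero}  c f = refl
  ∑-*ˡ {suc n} c f = trans
    (cong₂ _+_ (∑-*ˡ c (f ∘ (false ∷_))) (∑-*ˡ c (f ∘ (true ∷_))))
    (sym (*-distribˡ-+ c _ _))

  ∑-*ʳ : ∀ {n} (f : Vec Bool n → ℤ) c → ∑ (λ x → f x * c) ≡ ∑ f * c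
  ∑-*ʳ f c = trans (∑-cong (λ x → *-comm (f x) c)) (trans (∑-*ˡ c f) (*-comm c (∑ f)))

  2^_ : ℕ → ℤ
  2^ n = + (2 ℕ.^ n)

  2^-suc : ∀ n → 2^ (suc n) ≡ 2^ n + 2^ n
  2^-suc n = cong (λ k → + (2 ℕ.^ n ℕ.+ k)) (ℕₚ.+-identityʳ (2 ℕ.^ n))

  ∑-const : ∀ {n} c → ∑ {n} (λ _ → c) ≡ 2^ n * c
  ∑-const {zero}  c = sym (*-identityˡ c)
  ∑-const {suc n} c = trans (cong₂ _+_ (∑-const {n} c) (∑-const {n} c))
    (trans (sym (*-distribʳ-+ c (2^ n) (2^ n))) (cong (_* c) (sym (2^-suc n))))

  ∑-mono : ∀ {n} {f g : Vec Bool n → ℤ} → (∀ x → f x ≤ g x) → ∑ f ≤ ∑ g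
  ∑-mono {zero}  le = le []
  ∑-mono {suc n} le = +-mono-≤ (∑-mono (le ∘ (false ∷_))) (∑-mono (le ∘ (true ∷_)))

  ∑-swap : ∀ {m n} (f : Vec Bool m → Vec Bool n → ℤ) → ∑ (λ x → ∑ (f x)) ≡ ∑ (λ y → ∑ (λ x → f x y))
  ∑-swap {zero}  f = refl
  ∑-swap {suc m} f = trans
    (cong₂ _+_ (∑-swap (f ∘ (false ∷_))) (∑-swap (f ∘ (true ∷_))))
    (sym (∑-+ (λ y → ∑ (λ x → f (false ∷ x) y)) (λ y → ∑ (λ x → f (true ∷ x) y))))

  ∑-shift : ∀ {n} h (f : Vec Bool n → ℤ) → ∑ (λ x → f (x ⊕ h)) ≡ ∑ f
  ∑-shift []          f = refl
  ∑-shift (false ∷ h) f = cong₂ _+_ (∑-shift h (f ∘ (false ∷_))) (∑-shift h (f ∘ (true ∷_)))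
  ∑-shift (true ∷ h)  f = trans
    (cong₂ _+_ (∑-shift h (f ∘ (true ∷_))) (∑-shift h (f ∘ (false ∷_))))
    (+-comm (∑ (f ∘ (true ∷_))) (∑ (f ∘ (false ∷_))))

  ∑-square : ∀ {n} (f : Vec Bool n → ℤ) → ∑ f * ∑ f ≡ ∑ (λ h → ∑ (λ x → f x * f (x ⊕ h)))
  ∑-square f = begin
    ∑ f * ∑ f                            ≡⟨ ∑-*ʳ f (∑ f) ⟨
    ∑ (λ x → f x * ∑ f)                  ≡⟨ ∑-cong (λ x → row x) ⟩
    ∑ (λ x → ∑ (λ h → f x * f (x ⊕ h)))  ≡⟨ ∑-swap (λ x h → f x * f (x ⊕ h)) ⟩
    ∑ (λ h → ∑ (λ x → f x * f (x ⊕ h)))  ∎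
    where
    open ≡-Reasoning
    row : ∀ x → f x * ∑ f ≡ ∑ (λ h → f x * f (x ⊕ h))
    row x = trans (cong (f x *_) (trans (sym (∑-shift x f)) (∑-cong (λ h → cong f (⊕-comm h x)))))
                  (sym (∑-*ˡ (f x) (λ h → f (x ⊕ h))))

  0≤i*i : ∀ i → 0ℤ ≤ i * i
  0≤i*i (+ n)          = subst (0ℤ ≤_) (pos-* n n) (+≤+ ℕ.z≤n)
  0≤i*i (-[1+ n ]) = +≤+ ℕ.z≤n

  a+b≡c⇒a≤c : ∀ {a b c} → 0ℤ ≤ b → a + b ≡ c → a ≤ c
  a+b≡c⇒a≤c {a} 0≤b refl = ≤-trans (≤-reflexive (sym (+-identityʳ a))) (+-monoʳ-≤ a 0≤b)

  -- Induction on the dimension: (a + b)² ≤ 2 (a² + b²) costs one factor 2 per coordinate.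
  ∑-cauchySchwarz : ∀ {n} (f : Vec Bool n → ℤ) → ∑ f * ∑ f ≤ 2^ n * ∑ (λ x → f x * f x)
  ∑-cauchySchwarz {zero}  f = ≤-reflexive (sym (*-identityˡ _))
  ∑-cauchySchwarz {suc n} f = begin
    (a + b) * (a + b)              ≤⟨ a+b≡c⇒a≤c (0≤i*i (a + - b)) (parallelogram a b) ⟩
    (a * a + b * b) + (a * a + b * b)
      ≤⟨ +-mono-≤ both both ⟩
    (2^ n * A + 2^ n * B) + (2^ n * A + 2^ n * B)
      ≡⟨ regroup (2^ n) A B ⟩
    (2^ n + 2^ n) * (A + B)        ≡⟨ cong (_* (A + B)) (2^-suc n) ⟨
    2^ (suc n) * (A + B)           ∎
    where
    open ≤-Reasoning
    a = ∑ (f ∘ (false ∷_))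
    b = ∑ (f ∘ (true ∷_))
    A = ∑ (λ x → f (false ∷ x) * f (false ∷ x))
    B = ∑ (λ x → f (true ∷ x) * f (true ∷ x))
    both : a * a + b * b ≤ 2^ n * A + 2^ n * B
    both = +-mono-≤ (∑-cauchySchwarz (f ∘ (false ∷_))) (∑-cauchySchwarz (f ∘ (true ∷_)))
    parallelogram : ∀ a b → (a + b) * (a + b) + (a + - b) * (a + - b) ≡ (a * a + b * b) + (a * a + b * b)
    parallelogram = solve-∀
    regroup : ∀ c A B → (c * A + c * B) + (c * A + c * B) ≡ (c + c) * (A + B)
    regroup = solve-∀

  ⟦_⟧ : Bool → ℤ
  ⟦ false ⟧ = 0ℤ
  ⟦ true ⟧  = 1ℤ

  0≤⟦⟧ : ∀ b → 0ℤ ≤ ⟦ b ⟧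
  0≤⟦⟧ false = ≤-refl
  0≤⟦⟧ true  = +≤+ ℕ.z≤n

  ⟦⟧≤1 : ∀ b → ⟦ b ⟧ ≤ 1ℤ
  ⟦⟧≤1 false = +≤+ ℕ.z≤n
  ⟦⟧≤1 true  = ≤-refl

  ∑-zero : ∀ {n} → ∑ {n} (λ _ → 0ℤ) ≡ 0ℤ
  ∑-zero {n} = trans (∑-const {n} 0ℤ) (*-zeroʳ (2^ n))

  ∑-nonNeg : ∀ {n} {f : Vec Bool n → ℤ} → (∀ x → 0ℤ ≤ f x) → 0ℤ ≤ ∑ f
  ∑-nonNeg {n} 0≤f = ≤-trans (≤-reflexive (sym (∑-zero {n}))) (∑-mono 0≤f)

  ∑⟦⟧≥1 : ∀ {n} (P : Vec Bool n → Bool) x → P x ≡ true → 1ℤ ≤ ∑ (⟦_⟧ ∘ P)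
  ∑⟦⟧≥1 P []          eq = ≤-reflexive (cong ⟦_⟧ (sym eq))
  ∑⟦⟧≥1 P (false ∷ x) eq = +-mono-≤ (∑⟦⟧≥1 (P ∘ (false ∷_)) x eq) (∑-nonNeg (λ y → 0≤⟦⟧ (P (true ∷ y))))
  ∑⟦⟧≥1 P (true ∷ x)  eq = +-mono-≤ (∑-nonNeg (λ y → 0≤⟦⟧ (P (false ∷ y)))) (∑⟦⟧≥1 (P ∘ (true ∷_)) x eq)

  any-or-none : ∀ {n} (P : Vec Bool n → Bool) → (∃[ x ] P x ≡ true) ⊎ (∀ x → P x ≡ false)
  any-or-none {zero} P with P [] in eq
  ... | true  = inj₁ ([] , eq)
  ... | false = inj₂ λ { [] → eq }
  any-or-none {suc n} P with any-or-none (P ∘ (false ∷_)) | any-or-none (P ∘ (true ∷_))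
  ... | inj₁ (x , Px) | _             = inj₁ (false ∷ x , Px)
  ... | inj₂ _        | inj₁ (x , Px) = inj₁ (true ∷ x , Px)
  ... | inj₂ ¬P₀      | inj₂ ¬P₁      = inj₂ λ { (false ∷ x) → ¬P₀ x ; (true ∷ x) → ¬P₁ x }

  ∑⟦⟧≤1 : ∀ {n} (P : Vec Bool n → Bool) → (∀ x y → P x ≡ true → P y ≡ true → x ≡ y) → ∑ (⟦_⟧ ∘ P) ≤ 1ℤ
  ∑⟦⟧≤1 {zero}  P unique = ⟦⟧≤1 (P [])
  ∑⟦⟧≤1 {suc n} P unique with any-or-none (P ∘ (false ∷_))
  ... | inj₁ (x , Px) = +-mono-≤
    (∑⟦⟧≤1 (P ∘ (false ∷_)) (λ y z Py Pz → cong tail (unique (false ∷ y) (false ∷ z) Py Pz)))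
    (≤-reflexive (trans (∑-cong (λ y → cong ⟦_⟧ (¬-not (λ Py → true∉ (unique (true ∷ y) (false ∷ x) Py Px))))) (∑-zero {n})))
    where
    true∉ : ∀ {y x : Vec Bool n} → ¬ true ∷ y ≡ false ∷ x
    true∉ ()
  ... | inj₂ none = +-mono-≤
    (≤-reflexive (trans (∑-cong (λ x → cong ⟦_⟧ (none x))) (∑-zero {n})))
    (∑⟦⟧≤1 (P ∘ (true ∷_)) (λ y z Py Pz → cong tail (unique (true ∷ y) (true ∷ z) Py Pz)))

  -- Pigeonhole by double counting the 2^m pairs (v, f v). Comparing exponents rather than powers,
  -- it later replaces a dimension argument from linear algebra.
  injection⇒≤ : ∀ {m n} (f : Vec Bool m → Vec Bool n) → (∀ v w → f v ≡ f w → v ≡ w) → m ℕ.≤ n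
  injection⇒≤ {m} {n} f injective = ℕₚ.≮⇒≥ λ n<m → ℕₚ.<⇒≱ (ℕₚ.^-monoʳ-< 2 (ℕ.s≤s (ℕ.s≤s ℕ.z≤n)) n<m) (drop‿+≤+ (begin
    2^ m                                   ≡⟨ trans (∑-const {m} 1ℤ) (*-identityʳ (2^ m)) ⟨
    ∑ {m} (λ _ → 1ℤ)                       ≤⟨ ∑-mono (λ v → ∑⟦⟧≥1 (hits v) (f v) (dec-true (f v ≟ᵥ f v) refl)) ⟩
    ∑ (λ v → ∑ (λ w → ⟦ hits v w ⟧))       ≡⟨ ∑-swap (λ v w → ⟦ hits v w ⟧) ⟩
    ∑ (λ w → ∑ (λ v → ⟦ hits v w ⟧))       ≤⟨ ∑-mono (λ w → ∑⟦⟧≤1 (λ v → hits v w) (λ u v Pu Pv →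
                                                injective u v (trans (hit u w Pu) (sym (hit v w Pv))))) ⟩
    ∑ {n} (λ _ → 1ℤ)                       ≡⟨ trans (∑-const {n} 1ℤ) (*-identityʳ (2^ n)) ⟩
    2^ n                                   ∎))
    where
    open ≤-Reasoning
    _≟ᵥ_ = ≡-dec Bool._≟_
    hits : Vec Bool m → Vec Bool n → Bool
    hits v w = does (f v ≟ᵥ w)
    hit : ∀ v w → hits v w ≡ true → f v ≡ w
    hit v w eq with f v ≟ᵥ w
    hit v w eq | yes p = p
    hit v w () | no _

  count≡∑ : ∀ {n} (S : Vec Bool n → Bool) → + count S ≡ ∑ (⟦_⟧ ∘ S)
  count≡∑ {zero} S with S []
  ... | false = refl
  ... | true  = refl
  count≡∑ {suc n} S = cong₂ _+_ (count≡∑ (S ∘ (false ∷_))) (count≡∑ (S ∘ (true ∷_)))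

open CubeSums

-- Eighth roots of unity and the fourth moment of the correlation

module Moments where
  open import Data.Integer using (ℤ; +_; +≤+; -≤+; -_; _+_; _*_; _≤_; 0ℤ; 1ℤ; -1ℤ; nonNegative)
  open import Data.Integer.Properties
  open import Data.Integer.Tactic.RingSolver using (solve-∀)

  sign-not : ∀ b → sign (not b) ≡ - sign b
  sign-not false = refl
  sign-not true  = refl

  sign-xor : ∀ a b → sign (a xor b) ≡ sign a * sign b
  sign-xor false b = sym (*-identityˡ (sign b))
  sign-xor true  b = trans (sign-not b) (sym (-1*i≡-i (sign b)))

  -- The constant coefficient of ωⁿ in ℤ[ω], where ω is a primitive eighth root of unity
  -- and 1, ω, ω², ω³ is the basis.
  κ : ℕ → ℤ
  κ 0                         = 1ℤ
  κ 1                         = 0ℤ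
  κ 2                         = 0ℤ
  κ 3                         = 0ℤ
  κ (suc (suc (suc (suc n)))) = - κ n

  -- The constant coefficient of ωᵐ times the conjugate of ωⁿ, hence a function of m - n.
  K : ℕ → ℕ → ℤ
  K m n = κ m * κ n + κ (1 ℕ.+ m) * κ (1 ℕ.+ n) + κ (2 ℕ.+ m) * κ (2 ℕ.+ n) + κ (3 ℕ.+ m) * κ (3 ℕ.+ n)

  -- The first product moves to the end, where the two signs from ω⁴ = -1 cancel.
  K-suc : ∀ m n → K (suc m) (suc n) ≡ K m n
  K-suc m n = lemma (κ m) (κ n) (κ (1 ℕ.+ m) * κ (1 ℕ.+ n)) (κ (2 ℕ.+ m) * κ (2 ℕ.+ n)) (κ (3 ℕ.+ m) * κ (3 ℕ.+ n))
    where
    lemma : ∀ a b p q r → p + q + r + (- a) * (- b) ≡ a * b + p + q + r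
    lemma = solve-∀

  K-+ : ∀ t m n → K (t ℕ.+ m) (t ℕ.+ n) ≡ K m n
  K-+ zero    m n = refl
  K-+ (suc t) m n = trans (K-suc (t ℕ.+ m) (t ℕ.+ n)) (K-+ t m n)

  K-difference : ∀ {m n s t} → m ℕ.+ t ≡ n ℕ.+ s → K m n ≡ K s t
  K-difference {m} {n} {s} {t} eq = begin
    K m n                    ≡⟨ K-+ t m n ⟨
    K (t ℕ.+ m) (t ℕ.+ n)    ≡⟨ cong₂ K (trans (ℕₚ.+-comm t m) eq) (ℕₚ.+-comm t n) ⟩
    K (n ℕ.+ s) (n ℕ.+ t)    ≡⟨ K-+ n s t ⟩
    K s t                    ∎
    where open ≡-Reasoning

  κ-odd : ∀ n → κ (suc (2 ℕ.* n)) ≡ 0ℤ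
  κ-odd zero          = refl
  κ-odd (suc zero)    = refl
  κ-odd (suc (suc n)) = trans (cong (λ m → κ (suc m)) (4+ n)) (cong -_ (κ-odd n))
    where
    4+ : ∀ n → 2 ℕ.* (2 ℕ.+ n) ≡ 4 ℕ.+ 2 ℕ.* n
    4+ = ℕ-Ring.solve-∀

  -- ω^(2n) is a fourth root of unity, so its odd coordinates vanish. This reduces the four sums `Z`
  -- to the two sums `A`.
  K-even : ∀ n t → K (2 ℕ.* n) t ≡ κ (2 ℕ.* n) * κ t + κ (2 ℕ.+ 2 ℕ.* n) * κ (2 ℕ.+ t)
  K-even n t = trans
    (cong₂ (λ u v → κ (2 ℕ.* n) * κ t + u * κ (1 ℕ.+ t) + κ (2 ℕ.+ 2 ℕ.* n) * κ (2 ℕ.+ t) + v * κ (3 ℕ.+ t))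
      (κ-odd n) (trans (cong (λ m → κ (suc m)) (2+ n)) (κ-odd (suc n))))
    (lemma (κ (2 ℕ.* n) * κ t) (κ (1 ℕ.+ t)) (κ (2 ℕ.+ 2 ℕ.* n) * κ (2 ℕ.+ t)) (κ (3 ℕ.+ t)))
    where
    2+ : ∀ n → 2 ℕ.+ 2 ℕ.* n ≡ 2 ℕ.* suc n
    2+ = ℕ-Ring.solve-∀
    lemma : ∀ a b c d → a + 0ℤ * b + c + 0ℤ * d ≡ a + c
    lemma = solve-∀

  κ-4*wt : ∀ {n} (x : Vec Bool n) → κ (2 ℕ.* (2 ℕ.* wt x)) ≡ sign (parity x)
  κ-4*wt []          = refl
  κ-4*wt (false ∷ x) = κ-4*wt x
  κ-4*wt (true ∷ x)  = begin
    κ (2 ℕ.* (2 ℕ.* suc (wt x)))   ≡⟨ cong κ (4+ (wt x)) ⟩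
    - κ (2 ℕ.* (2 ℕ.* wt x))       ≡⟨ cong -_ (κ-4*wt x) ⟩
    - sign (parity x)              ≡⟨ sign-not (parity x) ⟨
    sign (not (parity x))          ∎
    where
    open ≡-Reasoning
    4+ : ∀ n → 2 ℕ.* (2 ℕ.* suc n) ≡ 4 ℕ.+ 2 ℕ.* (2 ℕ.* n)
    4+ = ℕ-Ring.solve-∀

  κ-4*+2 : ∀ n → κ (2 ℕ.+ 2 ℕ.* (2 ℕ.* n)) ≡ 0ℤ
  κ-4*+2 zero    = refl
  κ-4*+2 (suc n) = trans (cong (λ m → κ (2 ℕ.+ m)) (4+ n)) (cong -_ (κ-4*+2 n))
    where
    4+ : ∀ n → 2 ℕ.* (2 ℕ.* suc n) ≡ 4 ℕ.+ 2 ℕ.* (2 ℕ.* n)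
    4+ = ℕ-Ring.solve-∀

  κ-unit : ∀ n → κ n ≡ 0ℤ ⊎ (∃[ b ] κ n ≡ sign b)
  κ-unit 0 = inj₂ (false , refl)
  κ-unit 1 = inj₁ refl
  κ-unit 2 = inj₁ refl
  κ-unit 3 = inj₁ refl
  κ-unit (suc (suc (suc (suc n)))) with κ-unit n
  ... | inj₁ eq       = inj₁ (cong -_ eq)
  ... | inj₂ (b , eq) = inj₂ (not b , trans (cong -_ eq) (sym (sign-not b)))

  κ*sign≤1 : ∀ n b → κ n * sign b ≤ 1ℤ
  κ*sign≤1 n b with κ-unit n
  ... | inj₁ eq rewrite eq = subst (_≤ 1ℤ) (sym (*-zeroˡ (sign b))) (+≤+ ℕ.z≤n)
  ... | inj₂ (c , eq) rewrite eq = cases c b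
    where
    cases : ∀ c b → sign c * sign b ≤ 1ℤ
    cases false false = ≤-refl
    cases false true  = -≤+
    cases true  false = -≤+
    cases true  true  = ≤-refl

  -- The pair (κ t, κ (2 + t)) is zero for odd t and has exactly one nonzero entry, ± 1, for even t.
  κ-rotation : ∀ t a b → (a * κ t + b * κ (2 ℕ.+ t)) * (a * κ t + b * κ (2 ℕ.+ t)) ≤ a * a + b * b
  κ-rotation 0 a b = a+b≡c⇒a≤c (0≤i*i b) (lemma a b)
    where
    lemma : ∀ a b → (a * 1ℤ + b * 0ℤ) * (a * 1ℤ + b * 0ℤ) + b * b ≡ a * a + b * b
    lemma = solve-∀
  κ-rotation 1 a b = a+b≡c⇒a≤c (+-mono-≤ (0≤i*i a) (0≤i*i b)) (lemma a b)
    where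
    lemma : ∀ a b → (a * 0ℤ + b * 0ℤ) * (a * 0ℤ + b * 0ℤ) + (a * a + b * b) ≡ a * a + b * b
    lemma = solve-∀
  κ-rotation 2 a b = a+b≡c⇒a≤c (0≤i*i a) (lemma a b)
    where
    lemma : ∀ a b → (a * 0ℤ + b * - 1ℤ) * (a * 0ℤ + b * - 1ℤ) + a * a ≡ a * a + b * b
    lemma = solve-∀
  κ-rotation 3 a b = a+b≡c⇒a≤c (+-mono-≤ (0≤i*i a) (0≤i*i b)) (lemma a b)
    where
    lemma : ∀ a b → (a * 0ℤ + b * - 0ℤ) * (a * 0ℤ + b * - 0ℤ) + (a * a + b * b) ≡ a * a + b * b
    lemma = solve-∀
  κ-rotation (suc (suc (suc (suc t)))) a b =
    subst (_≤ a * a + b * b) (lemma a b (κ t) (κ (2 ℕ.+ t))) (κ-rotation t a b)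
    where
    lemma : ∀ a b u v → (a * u + b * v) * (a * u + b * v) ≡ (a * - u + b * - v) * (a * - u + b * - v)
    lemma = solve-∀

  binom₂ : ℕ → ℕ → Bool
  binom₂ zero    n       = true
  binom₂ (suc k) zero    = false
  binom₂ (suc k) (suc n) = binom₂ (suc k) n xor binom₂ k n

  elemSym≡binom₂ : ∀ k {n} (x : Vec Bool n) → elemSym k x ≡ binom₂ k (wt x)
  elemSym≡binom₂ zero    x           = refl
  elemSym≡binom₂ (suc k) []          = refl
  elemSym≡binom₂ (suc k) (false ∷ x) = trans (xor-identityʳ _) (elemSym≡binom₂ (suc k) x)
  elemSym≡binom₂ (suc k) (true ∷ x)  = cong₂ _xor_ (elemSym≡binom₂ (suc k) x) (elemSym≡binom₂ k x)

  -- (1 + z)⁴ = 1 + z⁴ over 𝔽₂.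
  binom₂-4+ : ∀ n → binom₂ 4 (4 ℕ.+ n) ≡ not (binom₂ 4 n)
  binom₂-4+ n = cases (binom₂ 4 n) (binom₂ 3 n) (binom₂ 2 n) (binom₂ 1 n)
    where
    cases : ∀ d c b a →
      (((d xor c) xor (c xor b)) xor ((c xor b) xor (b xor a))) xor
      (((c xor b) xor (b xor a)) xor ((b xor a) xor (a xor true))) ≡ not d
    cases false false false false = refl
    cases false false false true  = refl
    cases false false true  false = refl
    cases false false true  true  = refl
    cases false true  false false = refl
    cases false true  false true  = refl
    cases false true  true  false = refl
    cases false true  true  true  = refl
    cases true  false false false = refl
    cases true  false false true  = refl
    cases true  false true  false = refl
    cases true  false true  true  = refl
    cases true  true  false false = refl
    cases true  true  false true  = refl
    cases true  true  true  false = refl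
    cases true  true  true  true  = refl

  -- The binomial coefficient C(n, 4) is odd exactly when n has the binary digit 4. Its sign is thus
  -- antiperiodic with period 4, as ωⁿ is, and the values at n = 0, 1, 2, 3, all equal to 1, fix the
  -- four coefficients.
  sign-binom₂ : ∀ n → sign (binom₂ 4 n) ≡ κ n + - κ (1 ℕ.+ n) + - κ (2 ℕ.+ n) + - κ (3 ℕ.+ n)
  sign-binom₂ 0 = refl
  sign-binom₂ 1 = refl
  sign-binom₂ 2 = refl
  sign-binom₂ 3 = refl
  sign-binom₂ (suc (suc (suc (suc n)))) = begin
    sign (binom₂ 4 (4 ℕ.+ n))   ≡⟨ cong sign (binom₂-4+ n) ⟩
    sign (not (binom₂ 4 n))     ≡⟨ sign-not (binom₂ 4 n) ⟩
    - sign (binom₂ 4 n)         ≡⟨ cong -_ (sign-binom₂ n) ⟩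
    - (κ n + - κ (1 ℕ.+ n) + - κ (2 ℕ.+ n) + - κ (3 ℕ.+ n))
                                ≡⟨ lemma (κ n) (κ (1 ℕ.+ n)) (κ (2 ℕ.+ n)) (κ (3 ℕ.+ n)) ⟩
    - κ n + - - κ (1 ℕ.+ n) + - - κ (2 ℕ.+ n) + - - κ (3 ℕ.+ n) ∎
    where
    open ≡-Reasoning
    lemma : ∀ a b c d → - (a + - b + - c + - d) ≡ - a + - - b + - - c + - - d
    lemma = solve-∀

  ∑-antisymmetric : ∀ {n} (f : Vec Bool n → ℤ) a → (∀ x → f (x ⊕ a) ≡ - f x) → ∑ f ≡ 0ℤ
  ∑-antisymmetric f a anti = i≡-i⇒i≡0 (∑ f) (begin
    ∑ f                    ≡⟨ ∑-shift a f ⟨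
    ∑ (λ x → f (x ⊕ a))    ≡⟨ ∑-cong (λ x → trans (anti x) (sym (-1*i≡-i (f x)))) ⟩
    ∑ (λ x → -1ℤ * f x)    ≡⟨ ∑-*ˡ -1ℤ f ⟩
    -1ℤ * ∑ f              ≡⟨ -1*i≡-i (∑ f) ⟩
    - ∑ f                  ∎)
    where
    open ≡-Reasoning
    i≡-i⇒i≡0 : ∀ i → i ≡ - i → i ≡ 0ℤ
    i≡-i⇒i≡0 (+ zero)   _ = refl

  -- `W` marks the pairs whose phase may fail to cancel. For every other pair `balanced` gives a
  -- translation that flips the phase, which makes its sum zero. The analysis thus depends on the
  -- algebra of g through `W` alone.
  module FourthMoment {N : ℕ} (g : Vec Bool N → Bool) (W : Vec Bool N → Vec Bool N → Bool)
    (balanced : ∀ h k → W h k ≡ false → ∃[ a ] (∀ x → phase g h k (x ⊕ a) ≡ not (phase g h k x)))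
    where

    -- Up to sign, the coordinates of Σ ω^|x| (-1)^g(x) in ℤ[ω].
    Z : ℕ → ℤ
    Z i = ∑ (λ x → κ (i ℕ.+ wt x) * sign (g x))

    -- For i = 0 and 2, up to sign, the real and imaginary parts of a sum over x of fourth roots of unity.
    A : ℕ → Vec Bool N → ℤ
    A i h = ∑ (λ x → κ (i ℕ.+ 2 ℕ.* wt (x ⊙ h)) * sign (D h g x))

    corrSum≡Z : corrSum S4 g ≡ Z 0 + - Z 1 + - Z 2 + - Z 3
    corrSum≡Z = begin
      corrSum S4 g
        ≡⟨ corrSum≡∑ S4 g ⟩
      ∑ (λ x → sign (S4 x xor g x))
        ≡⟨ ∑-cong pointwise ⟩
      ∑ (λ x → F 0 x + -1ℤ * F 1 x + -1ℤ * F 2 x + -1ℤ * F 3 x)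
        ≡⟨ ∑-+ (λ x → F 0 x + -1ℤ * F 1 x + -1ℤ * F 2 x) (λ x → -1ℤ * F 3 x) ⟩
      ∑ (λ x → F 0 x + -1ℤ * F 1 x + -1ℤ * F 2 x) + ∑ (λ x → -1ℤ * F 3 x)
        ≡⟨ cong₂ _+_ (∑-+ (λ x → F 0 x + -1ℤ * F 1 x) (λ x → -1ℤ * F 2 x)) (negated 3) ⟩
      ∑ (λ x → F 0 x + -1ℤ * F 1 x) + ∑ (λ x → -1ℤ * F 2 x) + - Z 3
        ≡⟨ cong (_+ - Z 3) (cong₂ _+_ (∑-+ (F 0) (λ x → -1ℤ * F 1 x)) (negated 2)) ⟩
      Z 0 + ∑ (λ x → -1ℤ * F 1 x) + - Z 2 + - Z 3
        ≡⟨ cong (λ z → Z 0 + z + - Z 2 + - Z 3) (negated 1) ⟩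
      Z 0 + - Z 1 + - Z 2 + - Z 3 ∎
      where
      open ≡-Reasoning
      F : ℕ → Vec Bool N → ℤ
      F i x = κ (i ℕ.+ wt x) * sign (g x)
      negated : ∀ i → ∑ (λ x → -1ℤ * F i x) ≡ - Z i
      negated i = trans (∑-*ˡ -1ℤ (F i)) (-1*i≡-i (Z i))
      distrib : ∀ a b c d s → (a + - b + - c + - d) * s ≡ a * s + -1ℤ * (b * s) + -1ℤ * (c * s) + -1ℤ * (d * s)
      distrib = solve-∀
      pointwise : ∀ x → sign (S4 x xor g x) ≡ F 0 x + -1ℤ * F 1 x + -1ℤ * F 2 x + -1ℤ * F 3 x
      pointwise x = begin
        sign (S4 x xor g x)
          ≡⟨ sign-xor (S4 x) (g x) ⟩
        sign (S4 x) * sign (g x)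
          ≡⟨ cong (λ b → sign b * sign (g x)) (elemSym≡binom₂ 4 x) ⟩
        sign (binom₂ 4 (wt x)) * sign (g x)
          ≡⟨ cong (_* sign (g x)) (sign-binom₂ (wt x)) ⟩
        (κ (wt x) + - κ (1 ℕ.+ wt x) + - κ (2 ℕ.+ wt x) + - κ (3 ℕ.+ wt x)) * sign (g x)
          ≡⟨ distrib (κ (wt x)) (κ (1 ℕ.+ wt x)) (κ (2 ℕ.+ wt x)) (κ (3 ℕ.+ wt x)) (sign (g x)) ⟩
        F 0 x + -1ℤ * F 1 x + -1ℤ * F 2 x + -1ℤ * F 3 x ∎

    E₂ : ℤ
    E₂ = Z 0 * Z 0 + Z 1 * Z 1 + Z 2 * Z 2 + Z 3 * Z 3

    corrSum²≤4E₂ : corrSum S4 g * corrSum S4 g ≤ + 4 * E₂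
    corrSum²≤4E₂ = subst (λ c → c * c ≤ + 4 * E₂) (sym corrSum≡Z)
      -- Lagrange's identity for the coefficient vector (1, -1, -1, -1): the deficit in
      -- Cauchy-Schwarz is a sum of six squares.
      (a+b≡c⇒a≤c
        (+-mono-≤ (+-mono-≤ (+-mono-≤ (+-mono-≤ (+-mono-≤ (0≤i*i (Z 0 + Z 1)) (0≤i*i (Z 0 + Z 2))) (0≤i*i (Z 0 + Z 3)))
          (0≤i*i (Z 1 + - Z 2))) (0≤i*i (Z 1 + - Z 3))) (0≤i*i (Z 2 + - Z 3)))
        (lagrange (Z 0) (Z 1) (Z 2) (Z 3)))
      where
      lagrange : ∀ a b c d → (a + - b + - c + - d) * (a + - b + - c + - d) +
        ((a + b) * (a + b) + (a + c) * (a + c) + (a + d) * (a + d) +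
         (b + - c) * (b + - c) + (b + - d) * (b + - d) + (c + - d) * (c + - d))
        ≡ + 4 * (a * a + b * b + c * c + d * d)
      lagrange = solve-∀

    product : ∀ u v a b → (u * sign a) * (v * sign b) ≡ u * v * sign (a xor b)
    product u v a b = trans (shuffle u v (sign a) (sign b)) (cong (u * v *_) (sym (sign-xor a b)))
      where
      shuffle : ∀ u v s t → (u * s) * (v * t) ≡ u * v * (s * t)
      shuffle = solve-∀

    -- `E₂` is the constant coefficient of F times its conjugate, where F = Σ ω^|x| (-1)^g(x). The
    -- points x and x ⊕ h contribute ω^(2|x ⊙ h| - |h|): the factor depending on x is a fourth root
    -- of unity, and ω^-|h| leaves the inner sum.
    E₂≡∑ : E₂ ≡ ∑ (λ h → A 0 h * κ (wt h) + A 2 h * κ (2 ℕ.+ wt h))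
    E₂≡∑ = begin
      E₂
        ≡⟨ cong₂ _+_ (cong₂ _+_ (cong₂ _+_ (square 0) (square 1)) (square 2)) (square 3) ⟩
      ∑ (S 0) + ∑ (S 1) + ∑ (S 2) + ∑ (S 3)
        ≡⟨ cong (λ s → s + ∑ (S 2) + ∑ (S 3)) (∑-+ (S 0) (S 1)) ⟨
      ∑ (λ h → S 0 h + S 1 h) + ∑ (S 2) + ∑ (S 3)
        ≡⟨ cong (_+ ∑ (S 3)) (∑-+ (λ h → S 0 h + S 1 h) (S 2)) ⟨
      ∑ (λ h → S 0 h + S 1 h + S 2 h) + ∑ (S 3)
        ≡⟨ ∑-+ (λ h → S 0 h + S 1 h + S 2 h) (S 3) ⟨
      ∑ (λ h → S 0 h + S 1 h + S 2 h + S 3 h)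
        ≡⟨ ∑-cong slice ⟩
      ∑ (λ h → A 0 h * κ (wt h) + A 2 h * κ (2 ℕ.+ wt h)) ∎
      where
      open ≡-Reasoning
      t : ℕ → Vec Bool N → Vec Bool N → ℤ
      t i h x = κ (i ℕ.+ wt x) * κ (i ℕ.+ wt (x ⊕ h)) * sign (D h g x)
      S : ℕ → Vec Bool N → ℤ
      S i h = ∑ (t i h)
      square : ∀ i → Z i * Z i ≡ ∑ (S i)
      square i = trans (∑-square (λ x → κ (i ℕ.+ wt x) * sign (g x)))
        (∑-cong (λ h → ∑-cong (λ x → product (κ (i ℕ.+ wt x)) (κ (i ℕ.+ wt (x ⊕ h))) (g x) (g (x ⊕ h)))))
      collect : ∀ a b c d s → a * s + b * s + c * s + d * s ≡ (a + b + c + d) * s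
      collect = solve-∀
      expand : ∀ a b p q s → (a * p + b * q) * s ≡ a * s * p + b * s * q
      expand = solve-∀
      pointwise : ∀ h x → t 0 h x + t 1 h x + t 2 h x + t 3 h x ≡
        κ (2 ℕ.* wt (x ⊙ h)) * sign (D h g x) * κ (wt h) +
        κ (2 ℕ.+ 2 ℕ.* wt (x ⊙ h)) * sign (D h g x) * κ (2 ℕ.+ wt h)
      pointwise h x = begin
        t 0 h x + t 1 h x + t 2 h x + t 3 h x
          ≡⟨ collect (κ m * κ n) (κ (1 ℕ.+ m) * κ (1 ℕ.+ n)) (κ (2 ℕ.+ m) * κ (2 ℕ.+ n)) (κ (3 ℕ.+ m) * κ (3 ℕ.+ n)) s ⟩
        K m n * s
          ≡⟨ cong (_* s) (K-difference {m} {n} {2 ℕ.* wt (x ⊙ h)} {wt h} (wt-⊕ x h)) ⟩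
        K (2 ℕ.* wt (x ⊙ h)) (wt h) * s
          ≡⟨ cong (_* s) (K-even (wt (x ⊙ h)) (wt h)) ⟩
        (κ (2 ℕ.* wt (x ⊙ h)) * κ (wt h) + κ (2 ℕ.+ 2 ℕ.* wt (x ⊙ h)) * κ (2 ℕ.+ wt h)) * s
          ≡⟨ expand (κ (2 ℕ.* wt (x ⊙ h))) (κ (2 ℕ.+ 2 ℕ.* wt (x ⊙ h))) (κ (wt h)) (κ (2 ℕ.+ wt h)) s ⟩
        κ (2 ℕ.* wt (x ⊙ h)) * s * κ (wt h) + κ (2 ℕ.+ 2 ℕ.* wt (x ⊙ h)) * s * κ (2 ℕ.+ wt h) ∎
        where
        m = wt x
        n = wt (x ⊕ h)
        s = sign (D h g x)
      slice : ∀ h → S 0 h + S 1 h + S 2 h + S 3 h ≡ A 0 h * κ (wt h) + A 2 h * κ (2 ℕ.+ wt h)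
      slice h = begin
        S 0 h + S 1 h + S 2 h + S 3 h
          ≡⟨ cong (λ s → s + S 2 h + S 3 h) (∑-+ (t 0 h) (t 1 h)) ⟨
        ∑ (λ x → t 0 h x + t 1 h x) + S 2 h + S 3 h
          ≡⟨ cong (_+ S 3 h) (∑-+ (λ x → t 0 h x + t 1 h x) (t 2 h)) ⟨
        ∑ (λ x → t 0 h x + t 1 h x + t 2 h x) + S 3 h
          ≡⟨ ∑-+ (λ x → t 0 h x + t 1 h x + t 2 h x) (t 3 h) ⟨
        ∑ (λ x → t 0 h x + t 1 h x + t 2 h x + t 3 h x)
          ≡⟨ ∑-cong (pointwise h) ⟩
        ∑ (λ x → κ (2 ℕ.* wt (x ⊙ h)) * sign (D h g x) * κ (wt h) +
                 κ (2 ℕ.+ 2 ℕ.* wt (x ⊙ h)) * sign (D h g x) * κ (2 ℕ.+ wt h))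
          ≡⟨ ∑-+ (λ x → κ (2 ℕ.* wt (x ⊙ h)) * sign (D h g x) * κ (wt h))
                 (λ x → κ (2 ℕ.+ 2 ℕ.* wt (x ⊙ h)) * sign (D h g x) * κ (2 ℕ.+ wt h)) ⟩
        _ ≡⟨ cong₂ _+_ (∑-*ʳ (λ x → κ (2 ℕ.* wt (x ⊙ h)) * sign (D h g x)) (κ (wt h)))
                       (∑-*ʳ (λ x → κ (2 ℕ.+ 2 ℕ.* wt (x ⊙ h)) * sign (D h g x)) (κ (2 ℕ.+ wt h))) ⟩
        A 0 h * κ (wt h) + A 2 h * κ (2 ℕ.+ wt h) ∎

    -- The same differencing for fourth roots of unity: x and x ⊕ k contribute i^(2|x ⊙ h ⊙ k| - |k
    -- ⊙ h|). The factor depending on x is now a sign, so by `κ-4*+2` only the real part of i^-|k ⊙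
    -- h| survives in front.
    A²≡∑ : ∀ h → A 0 h * A 0 h + A 2 h * A 2 h ≡
      ∑ (λ k → κ (2 ℕ.* wt (k ⊙ h)) * ∑ (λ x → sign (phase g h k x)))
    A²≡∑ h = begin
      A 0 h * A 0 h + A 2 h * A 2 h
        ≡⟨ cong₂ _+_ (square 0) (square 2) ⟩
      ∑ (λ k → ∑ (t 0 k)) + ∑ (λ k → ∑ (t 2 k))
        ≡⟨ ∑-+ (λ k → ∑ (t 0 k)) (λ k → ∑ (t 2 k)) ⟨
      ∑ (λ k → ∑ (t 0 k) + ∑ (t 2 k))
        ≡⟨ ∑-cong (λ k → trans (sym (∑-+ (t 0 k) (t 2 k))) (∑-cong (pointwise k))) ⟩
      ∑ (λ k → ∑ (λ x → κ (2 ℕ.* wt (k ⊙ h)) * sign (phase g h k x)))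
        ≡⟨ ∑-cong (λ k → ∑-*ˡ (κ (2 ℕ.* wt (k ⊙ h))) (λ x → sign (phase g h k x))) ⟩
      ∑ (λ k → κ (2 ℕ.* wt (k ⊙ h)) * ∑ (λ x → sign (phase g h k x))) ∎
      where
      open ≡-Reasoning
      a : Vec Bool N → ℕ
      a x = wt (x ⊙ h)
      t : ℕ → Vec Bool N → Vec Bool N → ℤ
      t i k x = κ (i ℕ.+ 2 ℕ.* a x) * κ (i ℕ.+ 2 ℕ.* a (x ⊕ k)) * sign (D k (D h g) x)
      square : ∀ i → A i h * A i h ≡ ∑ (λ k → ∑ (t i k))
      square i = trans (∑-square (λ x → κ (i ℕ.+ 2 ℕ.* a x) * sign (D h g x)))
        (∑-cong (λ k → ∑-cong (λ x →
          product (κ (i ℕ.+ 2 ℕ.* a x)) (κ (i ℕ.+ 2 ℕ.* a (x ⊕ k))) (D h g x) (D h g (x ⊕ k)))))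
      weights : ∀ k x → 2 ℕ.* a x ℕ.+ 2 ℕ.* a k ≡ 2 ℕ.* a (x ⊕ k) ℕ.+ 2 ℕ.* (2 ℕ.* wt (x ⊙ (h ⊙ k)))
      weights k x = begin
        2 ℕ.* a x ℕ.+ 2 ℕ.* a k
          ≡⟨ ℕₚ.*-distribˡ-+ 2 (a x) (a k) ⟨
        2 ℕ.* (a x ℕ.+ a k)
          ≡⟨ cong (2 ℕ.*_) (wt-⊕ (x ⊙ h) (k ⊙ h)) ⟩
        2 ℕ.* (wt (x ⊙ h ⊕ k ⊙ h) ℕ.+ 2 ℕ.* wt ((x ⊙ h) ⊙ (k ⊙ h)))
          ≡⟨ cong₂ (λ u v → 2 ℕ.* (wt u ℕ.+ 2 ℕ.* wt v)) (sym (⊙-distribʳ-⊕ x k h)) (⊙-common x k h) ⟩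
        2 ℕ.* (a (x ⊕ k) ℕ.+ 2 ℕ.* wt (x ⊙ (h ⊙ k)))
          ≡⟨ ℕₚ.*-distribˡ-+ 2 (a (x ⊕ k)) _ ⟩
        2 ℕ.* a (x ⊕ k) ℕ.+ 2 ℕ.* (2 ℕ.* wt (x ⊙ (h ⊙ k))) ∎
      pointwise : ∀ k x → t 0 k x + t 2 k x ≡ κ (2 ℕ.* wt (k ⊙ h)) * sign (phase g h k x)
      pointwise k x = begin
        t 0 k x + t 2 k x
          ≡⟨ *-distribʳ-+ s (κ (2 ℕ.* a x) * κ m) (κ (2 ℕ.+ 2 ℕ.* a x) * κ (2 ℕ.+ m)) ⟨
        (κ (2 ℕ.* a x) * κ m + κ (2 ℕ.+ 2 ℕ.* a x) * κ (2 ℕ.+ m)) * s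
          ≡⟨ cong (_* s) (K-even (a x) m) ⟨
        K (2 ℕ.* a x) m * s
          ≡⟨ cong (_* s) (K-difference {2 ℕ.* a x} {m} {2 ℕ.* (2 ℕ.* c)} {2 ℕ.* a k} (weights k x)) ⟩
        K (2 ℕ.* (2 ℕ.* c)) (2 ℕ.* a k) * s
          ≡⟨ cong (_* s) (K-even (2 ℕ.* c) (2 ℕ.* a k)) ⟩
        (κ (2 ℕ.* (2 ℕ.* c)) * κ (2 ℕ.* a k) + κ (2 ℕ.+ 2 ℕ.* (2 ℕ.* c)) * κ (2 ℕ.+ 2 ℕ.* a k)) * s
          ≡⟨ cong₂ (λ u v → (u * κ (2 ℕ.* a k) + v * κ (2 ℕ.+ 2 ℕ.* a k)) * s)
               (κ-4*wt (x ⊙ (h ⊙ k))) (κ-4*+2 c) ⟩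
        (sign p * κ (2 ℕ.* a k) + 0ℤ * κ (2 ℕ.+ 2 ℕ.* a k)) * s
          ≡⟨ rearrange (sign p) (κ (2 ℕ.* a k)) (κ (2 ℕ.+ 2 ℕ.* a k)) s ⟩
        κ (2 ℕ.* a k) * (s * sign p)
          ≡⟨ cong (κ (2 ℕ.* a k) *_) (sign-xor (D k (D h g) x) p) ⟨
        κ (2 ℕ.* a k) * sign (phase g h k x) ∎
        where
        m = 2 ℕ.* a (x ⊕ k)
        c = wt (x ⊙ (h ⊙ k))
        p = parity (x ⊙ (h ⊙ k))
        s = sign (D k (D h g) x)
        rearrange : ∀ p q r s → (p * q + 0ℤ * r) * s ≡ q * (s * p)
        rearrange = solve-∀

    inner≤ : ∀ h k → κ (2 ℕ.* wt (k ⊙ h)) * ∑ (λ x → sign (phase g h k x)) ≤ 2^ N * ⟦ W h k ⟧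
    inner≤ h k with W h k in eq
    ... | false = ≤-reflexive (begin
      c * ∑ (λ x → sign (phase g h k x))
        ≡⟨ cong (c *_) (∑-antisymmetric _ a (λ x → trans (cong sign (flip x)) (sign-not (phase g h k x)))) ⟩
      c * 0ℤ        ≡⟨ *-zeroʳ c ⟩
      0ℤ            ≡⟨ *-zeroʳ (2^ N) ⟨
      2^ N * 0ℤ     ∎)
      where
      open ≡-Reasoning
      c = κ (2 ℕ.* wt (k ⊙ h))
      a = proj₁ (balanced h k eq)
      flip = proj₂ (balanced h k eq)
    ... | true = begin
      c * ∑ (λ x → sign (phase g h k x))   ≡⟨ ∑-*ˡ c (λ x → sign (phase g h k x)) ⟨
      ∑ (λ x → c * sign (phase g h k x))   ≤⟨ ∑-mono (λ x → κ*sign≤1 (2 ℕ.* wt (k ⊙ h)) (phase g h k x)) ⟩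
      ∑ {N} (λ x → 1ℤ)                     ≡⟨ ∑-const {N} 1ℤ ⟩
      2^ N * 1ℤ                            ∎
      where
      open ≤-Reasoning
      c = κ (2 ℕ.* wt (k ⊙ h))

    #W : ℤ
    #W = ∑ (λ h → ∑ (λ k → ⟦ W h k ⟧))

    E₂²≤ : E₂ * E₂ ≤ 2^ N * (2^ N * #W)
    E₂²≤ = begin
      E₂ * E₂
        ≡⟨ cong₂ _*_ E₂≡∑ E₂≡∑ ⟩
      ∑ T * ∑ T
        ≤⟨ ∑-cauchySchwarz T ⟩
      2^ N * ∑ (λ h → T h * T h)
        ≤⟨ *-monoˡ-≤-nonNeg (2^ N) (∑-mono (λ h → κ-rotation (wt h) (A 0 h) (A 2 h))) ⟩
      2^ N * ∑ (λ h → A 0 h * A 0 h + A 2 h * A 2 h)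
        ≤⟨ *-monoˡ-≤-nonNeg (2^ N) (∑-mono (λ h → ≤-trans (≤-reflexive (A²≡∑ h)) (∑-mono (inner≤ h)))) ⟩
      2^ N * ∑ (λ h → ∑ (λ k → 2^ N * ⟦ W h k ⟧))
        ≡⟨ cong (2^ N *_) (trans (∑-cong (λ h → ∑-*ˡ (2^ N) (λ k → ⟦ W h k ⟧))) (∑-*ˡ (2^ N) (λ h → ∑ (λ k → ⟦ W h k ⟧)))) ⟩
      2^ N * (2^ N * #W) ∎
      where
      open ≤-Reasoning
      T : Vec Bool N → ℤ
      T h = A 0 h * κ (wt h) + A 2 h * κ (2 ℕ.+ wt h)

    *-mono-square : ∀ {i j} → 0ℤ ≤ i → i ≤ j → i * i ≤ j * j
    *-mono-square {i} {j} 0≤i i≤j = ≤-trans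
      (*-monoˡ-≤-nonNeg i {{nonNegative 0≤i}} i≤j)
      (*-monoʳ-≤-nonNeg j {{nonNegative (≤-trans 0≤i i≤j)}} i≤j)

    fourthMoment : (corrSum S4 g * corrSum S4 g) * (corrSum S4 g * corrSum S4 g) ≤ + 16 * (2^ N * (2^ N * #W))
    fourthMoment = begin
      (c * c) * (c * c)             ≤⟨ *-mono-square (0≤i*i c) corrSum²≤4E₂ ⟩
      (+ 4 * E₂) * (+ 4 * E₂)       ≡⟨ regroup E₂ ⟩
      + 16 * (E₂ * E₂)              ≤⟨ *-monoˡ-≤-nonNeg (+ 16) E₂²≤ ⟩
      + 16 * (2^ N * (2^ N * #W))   ∎
      where
      open ≤-Reasoning
      c = corrSum S4 g
      regroup : ∀ x → (+ 4 * x) * (+ 4 * x) ≡ + 16 * (x * x)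
      regroup = solve-∀

open Moments

-- Discrete derivatives

-- Degree is measured by derivatives, because what the argument uses of a cubic is that its third
-- derivatives are constant.
IsDeg : ∀ {n} → ℕ → (Vec Bool n → Bool) → Set
IsDeg zero    f = ∀ x y → f x ≡ f y
IsDeg (suc d) f = ∀ h → IsDeg d (D h f)

D-cong : ∀ {n} {f g : Vec Bool n → Bool} h → (∀ x → f x ≡ g x) → ∀ x → D h f x ≡ D h g x
D-cong h eq x = cong₂ _xor_ (eq x) (eq (x ⊕ h))

D-comm : ∀ {n} h k (f : Vec Bool n → Bool) x → D h (D k f) x ≡ D k (D h f) x
D-comm h k f x = trans (xor-interchange (f x) (f (x ⊕ k)) (f (x ⊕ h)) (f (x ⊕ h ⊕ k)))
  (cong (λ y → (f x xor f (x ⊕ h)) xor (f (x ⊕ k) xor f y)) (⊕-swapʳ x h k))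

D-self : ∀ {n} h (f : Vec Bool n → Bool) x → D h (D h f) x ≡ false
D-self h f x = trans (xor-telescope (f x) (f (x ⊕ h)) (f (x ⊕ h ⊕ h)))
  (trans (cong (λ y → f x xor f y) (trans (⊕-assoc x h h) (trans (cong (x ⊕_) (⊕-self h)) (⊕-identityʳ x))))
         (xor-same (f x)))

D-⊕ : ∀ {n} h k (f : Vec Bool n → Bool) x → D (h ⊕ k) f x ≡ D h f x xor D k f (x ⊕ h)
D-⊕ h k f x = trans (cong (λ y → f x xor f y) (sym (⊕-assoc x h k)))
  (sym (xor-telescope (f x) (f (x ⊕ h)) (f (x ⊕ h ⊕ k))))

IsDeg-cong : ∀ d {n} {f g : Vec Bool n → Bool} → (∀ x → f x ≡ g x) → IsDeg d f → IsDeg d g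
IsDeg-cong zero    eq df x y = trans (sym (eq x)) (trans (df x y) (eq y))
IsDeg-cong (suc d) eq df h   = IsDeg-cong d (D-cong h eq) (df h)

IsDeg-suc : ∀ d {n} {f : Vec Bool n → Bool} → IsDeg d f → IsDeg (suc d) f
IsDeg-suc zero    df h x y = cong₂ _xor_ (df x y) (df (x ⊕ h) (y ⊕ h))
IsDeg-suc (suc d) df h     = IsDeg-suc d (df h)

IsDeg-≤ : ∀ {c d n} {f : Vec Bool n → Bool} → c ℕ.≤ d → IsDeg c f → IsDeg d f
IsDeg-≤ {d = zero}  ℕ.z≤n       df   = df
IsDeg-≤ {d = suc d} ℕ.z≤n       df   = IsDeg-suc d (IsDeg-≤ {d = d} ℕ.z≤n df)
IsDeg-≤             (ℕ.s≤s c≤d) df h = IsDeg-≤ c≤d (df h)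

IsDeg-xor : ∀ d {n} {f g : Vec Bool n → Bool} → IsDeg d f → IsDeg d g → IsDeg d (λ x → f x xor g x)
IsDeg-xor zero            df dg x y = cong₂ _xor_ (df x y) (dg x y)
IsDeg-xor (suc d) {f = f} {g} df dg h = IsDeg-cong d
  (λ x → xor-interchange (f x) (f (x ⊕ h)) (g x) (g (x ⊕ h)))
  (IsDeg-xor d (df h) (dg h))

IsDeg-∧ : ∀ d {n} b {f : Vec Bool n → Bool} → IsDeg d f → IsDeg d (λ x → b ∧ f x)
IsDeg-∧ d true  df = df
IsDeg-∧ d false df = IsDeg-≤ {0} {d} ℕ.z≤n (λ _ _ → refl)

IsDeg-shift : ∀ d {n} {f : Vec Bool n → Bool} a → IsDeg d f → IsDeg d (λ x → f (x ⊕ a))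
IsDeg-shift zero            a df x y = df (x ⊕ a) (y ⊕ a)
IsDeg-shift (suc d) {f = f} a df h   = IsDeg-cong d
  (λ x → cong (λ y → f (x ⊕ a) xor f y) (⊕-swapʳ x a h)) (IsDeg-shift d a (df h))

-- Leibniz rule: the derivative of xᵢ f along h is xᵢ (D h f) + hᵢ f(x ⊕ h). The first term has
-- degree d by induction; for d = 0 it vanishes, f being constant.
IsDeg-lookup : ∀ d {n} (i : Fin n) {f : Vec Bool n → Bool} → IsDeg d f → IsDeg (suc d) (λ x → lookup x i ∧ f x)
IsDeg-lookup d i {f} df h = IsDeg-cong d
  (λ x → trans (leibniz (lookup x i) (lookup h i) (f x) (f (x ⊕ h)))
               (cong (λ b → (lookup x i ∧ f x) xor (b ∧ f (x ⊕ h))) (sym (lookup-zipWith _xor_ i x h))))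
  (IsDeg-xor d (lookup∧D d df) (IsDeg-∧ d (lookup h i) (IsDeg-shift d h df)))
  where
  leibniz : ∀ a b u v → (a ∧ (u xor v)) xor (b ∧ v) ≡ (a ∧ u) xor ((a xor b) ∧ v)
  leibniz false b     u     v = refl
  leibniz true  false u     v = xor-identityʳ (u xor v)
  leibniz true  true  u     v = trans (xor-assoc u v v) (cong (u xor_) (xor-same v))
  lookup∧D : ∀ d → IsDeg d f → IsDeg d (λ x → lookup x i ∧ D h f x)
  lookup∧D zero    df x y = trans (vanishes x) (sym (vanishes y))
    where
    vanishes : ∀ x → lookup x i ∧ D h f x ≡ false
    vanishes x = trans (cong (λ b → lookup x i ∧ (f x xor b)) (df (x ⊕ h) x))
                       (trans (cong (lookup x i ∧_) (xor-same (f x))) (∧-zeroʳ (lookup x i)))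
  lookup∧D (suc d) df = IsDeg-lookup d i (df h)

IsDeg-evalMono : ∀ {n} (m : Monomial n) → IsDeg (List.length m) (evalMono m)
IsDeg-evalMono List.[]      x y = refl
IsDeg-evalMono (i List.∷ m)     = IsDeg-lookup (List.length m) i (IsDeg-evalMono m)

IsDeg-evalPoly : ∀ {d n} (g : Poly n) → DegreeAtMost d g → IsDeg d (evalPoly g)
IsDeg-evalPoly {d} List.[]      []       = IsDeg-≤ {0} {d} ℕ.z≤n (λ _ _ → refl)
IsDeg-evalPoly {d} (m List.∷ g) (p ∷ ps) = IsDeg-xor d (IsDeg-≤ p (IsDeg-evalMono m)) (IsDeg-evalPoly g ps)

parity-⊕ : ∀ {n} (x y : Vec Bool n) → parity (x ⊕ y) ≡ parity x xor parity y
parity-⊕ []      []      = refl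
parity-⊕ (a ∷ x) (b ∷ y) = trans (cong ((a xor b) xor_) (parity-⊕ x y)) (xor-interchange a b (parity x) (parity y))

parity-𝟎⊙ : ∀ {n} (x : Vec Bool n) → parity (𝟎 ⊙ x) ≡ false
parity-𝟎⊙ []      = refl
parity-𝟎⊙ (b ∷ x) = parity-𝟎⊙ x

parity-e : ∀ {n} (a : Fin n) (x : Vec Bool n) → parity (e a ⊙ (x ⊙ e a)) ≡ lookup x a
parity-e zero    (b ∷ x) = trans (cong₂ _xor_ (∧-identityʳ b) (parity-𝟎⊙ (x ⊙ 𝟎))) (xor-identityʳ b)
parity-e (suc a) (b ∷ x) = parity-e a x

-- Φ h (e a) (e a) is the coordinate hₐ because D h (D h f) = 0 in characteristic 2. For the
-- nonclassical cubic |x| / 8, whose phase does correlate with S₄, the form Φ would vanish.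
module Polarization {N : ℕ} (g : Vec Bool N → Bool) (cubic : IsDeg 3 g) where

  T Φ : Vec Bool N → Vec Bool N → Vec Bool N → Bool
  T h k l = D l (D k (D h g)) 𝟎
  Φ h k l = T h k l xor parity (l ⊙ (h ⊙ k))

  T-swapʳ : ∀ h k l → T h k l ≡ T h l k
  T-swapʳ h k l = D-comm l k (D h g) 𝟎

  T-swapˡ : ∀ h k l → T h k l ≡ T k h l
  T-swapˡ h k l = D-cong l (D-comm k h g) 𝟎

  Φ-swapʳ : ∀ h k l → Φ h k l ≡ Φ h l k
  Φ-swapʳ h k l = cong₂ _xor_ (T-swapʳ h k l) (cong parity
    (trans (⊙-comm l (h ⊙ k)) (trans (⊙-assoc h k l) (trans (cong (h ⊙_) (⊙-comm k l))
      (trans (sym (⊙-assoc h l k)) (⊙-comm (h ⊙ l) k))))))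
    where
    ⊙-comm : ∀ {n} (x y : Vec Bool n) → x ⊙ y ≡ y ⊙ x
    ⊙-comm = zipWith-comm ∧-comm
    ⊙-assoc : ∀ {n} (x y z : Vec Bool n) → x ⊙ y ⊙ z ≡ x ⊙ (y ⊙ z)
    ⊙-assoc = zipWith-assoc ∧-assoc

  Φ-swapˡ : ∀ h k l → Φ h k l ≡ Φ k h l
  Φ-swapˡ h k l = cong₂ _xor_ (T-swapˡ h k l) (cong (λ x → parity (l ⊙ x)) (zipWith-comm ∧-comm h k))

  -- By `D-⊕` the derivative along l ⊕ l′ is a sum of two derivatives, the second at a shifted base
  -- point. Third derivatives of a cubic are constant, so the shift has no effect. The other two
  -- variables follow by symmetry.
  Φ-additive₃ : ∀ h k l l′ → Φ h k (l ⊕ l′) ≡ Φ h k l xor Φ h k l′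
  Φ-additive₃ h k l l′ = trans
    (cong₂ _xor_
      (trans (D-⊕ l l′ (D k (D h g)) 𝟎) (cong (T h k l xor_) (cubic h k l′ (𝟎 ⊕ l) 𝟎)))
      (trans (cong parity (⊙-distribʳ-⊕ l l′ (h ⊙ k))) (parity-⊕ (l ⊙ (h ⊙ k)) (l′ ⊙ (h ⊙ k)))))
    (xor-interchange (T h k l) (T h k l′) (parity (l ⊙ (h ⊙ k))) (parity (l′ ⊙ (h ⊙ k))))

  Φ-additive₂ : ∀ h k k′ l → Φ h (k ⊕ k′) l ≡ Φ h k l xor Φ h k′ l
  Φ-additive₂ h k k′ l = trans (Φ-swapʳ h (k ⊕ k′) l)
    (trans (Φ-additive₃ h l k k′) (cong₂ _xor_ (Φ-swapʳ h l k) (Φ-swapʳ h l k′)))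

  Φ-additive₁ : ∀ h h′ k l → Φ (h ⊕ h′) k l ≡ Φ h k l xor Φ h′ k l
  Φ-additive₁ h h′ k l = trans (Φ-swapˡ (h ⊕ h′) k l)
    (trans (Φ-additive₂ k h h′ l) (cong₂ _xor_ (Φ-swapˡ k h l) (Φ-swapˡ k h′ l)))

  Φ-diagonal : ∀ h a → Φ h (e a) (e a) ≡ lookup h a
  Φ-diagonal h a = cong₂ _xor_ (D-self (e a) (D h g) 𝟎) (parity-e a h)

  -- The phase is affine in x with linear part Φ h k, so any l with Φ h k l = 1 flips it everywhere.
  phase-⊕ : ∀ h k l x → phase g h k (x ⊕ l) ≡ phase g h k x xor Φ h k l
  phase-⊕ h k l x = trans
    (cong₂ _xor_
      (trans (sym (xor-cancelˡ (D k (D h g) x) _)) (cong (D k (D h g) x xor_) (cubic h k l x 𝟎)))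
      (trans (cong parity (⊙-distribʳ-⊕ x l (h ⊙ k))) (parity-⊕ (x ⊙ (h ⊙ k)) (l ⊙ (h ⊙ k)))))
    (xor-interchange (D k (D h g) x) (T h k l) (parity (x ⊙ (h ⊙ k))) (parity (l ⊙ (h ⊙ k))))

-- Symmetric determinants modulo 2

xor≡false⇒≡ : ∀ a b → a xor b ≡ false → a ≡ b
xor≡false⇒≡ false false _ = refl
xor≡false⇒≡ true  true  _ = refl

module _ {X : Set} where

  sumᵥ : ∀ {n} → (X → Bool) → Vec X n → Bool
  sumᵥ f []      = false
  sumᵥ f (a ∷ A) = f a xor sumᵥ f A

  sumᵥ-cong : ∀ {n} {f g : X → Bool} (A : Vec X n) → (∀ {a} → a ∈ A → f a ≡ g a) → sumᵥ f A ≡ sumᵥ g A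
  sumᵥ-cong []      eq = refl
  sumᵥ-cong (a ∷ A) eq = cong₂ _xor_ (eq (here refl)) (sumᵥ-cong A (eq ∘ there))

  sumᵥ-false : ∀ {n} (A : Vec X n) → sumᵥ (λ _ → false) A ≡ false
  sumᵥ-false []      = refl
  sumᵥ-false (a ∷ A) = sumᵥ-false A

  sumᵥ-xor : ∀ {n} (f g : X → Bool) (A : Vec X n) → sumᵥ (λ a → f a xor g a) A ≡ sumᵥ f A xor sumᵥ g A
  sumᵥ-xor f g []      = refl
  sumᵥ-xor f g (a ∷ A) = trans (cong ((f a xor g a) xor_) (sumᵥ-xor f g A))
    (xor-interchange (f a) (g a) (sumᵥ f A) (sumᵥ g A))

  sumᵥ-∧ : ∀ {n} b (f : X → Bool) (A : Vec X n) → sumᵥ (λ a → b ∧ f a) A ≡ b ∧ sumᵥ f A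
  sumᵥ-∧ b f []      = sym (∧-zeroʳ b)
  sumᵥ-∧ b f (a ∷ A) = trans (cong ((b ∧ f a) xor_) (sumᵥ-∧ b f A)) (sym (∧-distribˡ-xor b (f a) (sumᵥ f A)))

  -- The shape of an expansion along a row: a sum over positions, where f receives the entry there
  -- and the vector with that position deleted. Prepending `a` to `C` restores the entries already
  -- passed.
  pick : ∀ {n} → (X → Vec X n → Bool) → Vec X (suc n) → Bool
  pick f (a ∷ [])    = f a []
  pick f (a ∷ b ∷ A) = f a (b ∷ A) xor pick (λ c C → f c (a ∷ C)) (b ∷ A)

  pick-∷ : ∀ {n} (f : X → Vec X (suc n) → Bool) a (A : Vec X (suc n)) →
    pick f (a ∷ A) ≡ f a A xor pick (λ c C → f c (a ∷ C)) A
  pick-∷ f a (b ∷ A) = refl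

  pick-cong : ∀ {n} {f g : X → Vec X n → Bool} (A : Vec X (suc n)) →
    (∀ {a} → a ∈ A → ∀ B → f a B ≡ g a B) → pick f A ≡ pick g A
  pick-cong (a ∷ [])    eq = eq (here refl) []
  pick-cong (a ∷ b ∷ A) eq = cong₂ _xor_ (eq (here refl) (b ∷ A)) (pick-cong (b ∷ A) (λ c∈A C → eq (there c∈A) (a ∷ C)))

  pick-xor : ∀ {n} (f g : X → Vec X n → Bool) A → pick (λ a B → f a B xor g a B) A ≡ pick f A xor pick g A
  pick-xor f g (a ∷ [])    = refl
  pick-xor f g (a ∷ b ∷ A) = trans
    (cong ((f a (b ∷ A) xor g a (b ∷ A)) xor_) (pick-xor (λ c C → f c (a ∷ C)) (λ c C → g c (a ∷ C)) (b ∷ A)))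
    (xor-interchange (f a (b ∷ A)) (g a (b ∷ A)) _ _)

  pick-∧ : ∀ {n} x (f : X → Vec X n → Bool) A → pick (λ a B → x ∧ f a B) A ≡ x ∧ pick f A
  pick-∧ x f (a ∷ [])    = refl
  pick-∧ x f (a ∷ b ∷ A) = trans (cong ((x ∧ f a (b ∷ A)) xor_) (pick-∧ x (λ c C → f c (a ∷ C)) (b ∷ A)))
    (sym (∧-distribˡ-xor x (f a (b ∷ A)) _))

  pick₂ : ∀ {n} → (X → X → Vec X n → Bool) → Vec X (suc (suc n)) → Bool
  pick₂ f = pick (λ a → pick (f a))

  pick₂-∷ : ∀ {n} (f : X → X → Vec X (suc n) → Bool) a (A : Vec X (suc (suc n))) →
    pick₂ f (a ∷ A) ≡ pick (f a) A xor (pick (λ b B → f b a B) A xor pick₂ (λ b c C → f b c (a ∷ C)) A)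
  pick₂-∷ f a A = trans (pick-∷ (λ b → pick (f b)) a A) (cong (pick (f a) A xor_)
    (trans (pick-cong A (λ {b} _ B → pick-∷ (f b) a B)) (pick-xor (λ b B → f b a B) _ A)))

  pick₂-swap : ∀ {n} (f : X → X → Vec X n → Bool) A → pick₂ f A ≡ pick₂ (λ a b → f b a) A
  pick₂-swap {zero}  f (a ∷ b ∷ []) = xor-comm (f a b []) (f b a [])
  pick₂-swap {suc n} f (a ∷ A)      = begin
    pick₂ f (a ∷ A)                   ≡⟨ pick₂-∷ f a A ⟩
    P xor (Q xor pick₂ f′ A)          ≡⟨ xor-assoc P Q (pick₂ f′ A) ⟨
    (P xor Q) xor pick₂ f′ A          ≡⟨ cong₂ _xor_ (xor-comm P Q) (pick₂-swap f′ A) ⟩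
    (Q xor P) xor pick₂ f″ A          ≡⟨ xor-assoc Q P (pick₂ f″ A) ⟩
    Q xor (P xor pick₂ f″ A)          ≡⟨ pick₂-∷ (λ b c → f c b) a A ⟨
    pick₂ (λ b c → f c b) (a ∷ A)     ∎
    where
    open ≡-Reasoning
    f′ = λ b c C → f b c (a ∷ C)
    f″ = λ b c C → f c b (a ∷ C)
    P = pick (f a) A
    Q = pick (λ b B → f b a B) A

  -- Two positions are chosen in either order, and the two equal terms cancel modulo 2.
  pick₂-symmetric : ∀ {n} (f : X → X → Vec X n → Bool) → (∀ a b B → f a b B ≡ f b a B) → ∀ A → pick₂ f A ≡ false
  pick₂-symmetric {zero}  f s (a ∷ b ∷ []) = trans (cong (f a b [] xor_) (s b a [])) (xor-same (f a b []))
  pick₂-symmetric {suc n} f s (a ∷ A)      = begin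
    pick₂ f (a ∷ A)          ≡⟨ pick₂-∷ f a A ⟩
    P xor (Q xor _)          ≡⟨ cong₂ (λ q r → P xor (q xor r)) (pick-cong A (λ {b} _ B → s b a B))
                                  (pick₂-symmetric _ (λ b c C → s b c (a ∷ C)) A) ⟩
    P xor (P xor false)      ≡⟨ xor-cancelˡ P false ⟩
    false                    ∎
    where
    open ≡-Reasoning
    P = pick (f a) A
    Q = pick (λ b B → f b a B) A

  infix 4 _~_
  data _~_ : ∀ {n} → Vec X n → Vec X n → Set where
    ~-refl  : ∀ {n} {A : Vec X n} → A ~ A
    ~-prep  : ∀ {n} a {A B : Vec X n} → A ~ B → a ∷ A ~ a ∷ B
    ~-swap  : ∀ {n} a b {A : Vec X n} → a ∷ b ∷ A ~ b ∷ a ∷ A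
    ~-trans : ∀ {n} {A B C : Vec X n} → A ~ B → B ~ C → A ~ C

  ~-front : ∀ {n} {P : X → Set} {A : Vec X (suc n)} → Any P A → ∃[ a ] ∃[ B ] (P a × A ~ a ∷ B)
  ~-front (here p)                         = _ , _ , p , ~-refl
  ~-front {A = b ∷ _ ∷ _} (there i) with ~-front i
  ... | a , B , p , A~ = a , b ∷ B , p , ~-trans (~-prep b A~) (~-swap b a)

  ~-∈ : ∀ {n} {A B : Vec X n} {x} → A ~ B → x ∈ B → x ∈ A
  ~-∈ ~-refl        i                 = i
  ~-∈ (~-prep a p)  (here eq)         = here eq
  ~-∈ (~-prep a p)  (there i)         = there (~-∈ p i)
  ~-∈ (~-swap a b)  (here eq)         = there (here eq)
  ~-∈ (~-swap a b)  (there (here eq)) = here eq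
  ~-∈ (~-swap a b)  (there (there i)) = there (there i)
  ~-∈ (~-trans p q) i                 = ~-∈ p (~-∈ q i)

  sumᵥ-~ : ∀ {n} f {A B : Vec X n} → A ~ B → sumᵥ f A ≡ sumᵥ f B
  sumᵥ-~ f ~-refl        = refl
  sumᵥ-~ f (~-prep a p)  = cong (f a xor_) (sumᵥ-~ f p)
  sumᵥ-~ f (~-swap a b)  = trans (sym (xor-assoc (f a) (f b) _))
    (trans (cong (_xor _) (xor-comm (f a) (f b))) (xor-assoc (f b) (f a) _))
  sumᵥ-~ f (~-trans p q) = trans (sumᵥ-~ f p) (sumᵥ-~ f q)

  pick-~ : ∀ {n} (f : X → Vec X n → Bool) → (∀ a {B C} → B ~ C → f a B ≡ f a C) →
    ∀ {A B} → A ~ B → pick f A ≡ pick f B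
  pick-~ f r ~-refl = refl
  pick-~ {zero} f r (~-prep a {[]} {[]} p) = refl
  pick-~ {suc n} f r (~-prep a {A} {B} p) = begin
    pick f (a ∷ A)                          ≡⟨ pick-∷ f a A ⟩
    f a A xor pick (λ c C → f c (a ∷ C)) A  ≡⟨ cong₂ _xor_ (r a p) (pick-~ _ (λ c C~ → r c (~-prep a C~)) p) ⟩
    f a B xor pick (λ c C → f c (a ∷ C)) B  ≡⟨ pick-∷ f a B ⟨
    pick f (a ∷ B)                          ∎
    where open ≡-Reasoning
  pick-~ {suc zero} f r (~-swap a b {[]}) = xor-comm (f a (b ∷ [])) (f b (a ∷ []))
  pick-~ {suc (suc n)} f r (~-swap a b {c ∷ A}) = begin
    p xor (q xor pick (λ d C → f d (a ∷ b ∷ C)) (c ∷ A))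
      ≡⟨ xor-assoc p q _ ⟨
    (p xor q) xor pick (λ d C → f d (a ∷ b ∷ C)) (c ∷ A)
      ≡⟨ cong₂ _xor_ (xor-comm p q) (pick-cong (c ∷ A) (λ {d} _ C → r d (~-swap a b))) ⟩
    (q xor p) xor pick (λ d C → f d (b ∷ a ∷ C)) (c ∷ A)
      ≡⟨ xor-assoc q p _ ⟩
    q xor (p xor pick (λ d C → f d (b ∷ a ∷ C)) (c ∷ A)) ∎
    where
    open ≡-Reasoning
    p = f a (b ∷ c ∷ A)
    q = f b (a ∷ c ∷ A)
  pick-~ f r (~-trans p q) = trans (pick-~ f r p) (pick-~ f r q)

  -- The determinant modulo 2 of the symmetric matrix (M a b) indexed by A: a permutation and its
  -- inverse contribute equally, so only the involutions survive, and M a b * M b a = M a b.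
  det : ∀ {n} → (X → X → Bool) → Vec X n → Bool
  det {zero}        M []       = true
  det {suc zero}    M (a ∷ []) = M a a
  det {suc (suc n)} M (a ∷ A)  = (M a a ∧ det M A) xor pick (λ b B → M a b ∧ det M B) A

  module Det (M : X → X → Bool) (M-sym : ∀ a b → M a b ≡ M b a) where

    -- Partial sums over involutions: in `P a A` the index a is paired with a member of A; in
    -- `Q a b A` both a and b are paired with members at distinct positions, which needs at least
    -- two of them.
    P : ∀ {n} → X → Vec X (suc n) → Bool
    P a = pick (λ b B → M a b ∧ det M B)

    Q : ∀ {n} → X → X → Vec X (suc n) → Bool
    Q {zero}  a b A = false
    Q {suc n} a b A = pick₂ (λ c d C → M a c ∧ (M b d ∧ det M C)) A

    Q-swap : ∀ {n} a b (A : Vec X (suc n)) → Q a b A ≡ Q b a A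
    Q-swap {zero}  a b A = refl
    Q-swap {suc n} a b A = trans (pick₂-swap (λ c d C → M a c ∧ (M b d ∧ det M C)) A)
      (pick-cong A (λ {c} _ C → pick-cong C (λ {d} _ E → exchange (M a d) (M b c) (det M E))))
      where
      open xor-∧-Solver
      exchange : ∀ x y z → x ∧ (y ∧ z) ≡ y ∧ (x ∧ z)
      exchange = solve 3 (λ x y z → x :* (y :* z) := y :* (x :* z)) refl

    Q-self : ∀ {n} a (A : Vec X (suc n)) → Q a a A ≡ false
    Q-self {zero}  a A = refl
    Q-self {suc n} a A = pick₂-symmetric _ (λ c d C → exchange (M a c) (M a d) (det M C)) A
      where
      open xor-∧-Solver
      exchange : ∀ x y z → x ∧ (y ∧ z) ≡ y ∧ (x ∧ z)
      exchange = solve 3 (λ x y z → x :* (y :* z) := y :* (x :* z)) refl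

    -- Three cases: a is paired with b; b is fixed and a has a partner in A; both have partners in
    -- A.
    P-∷ : ∀ {n} a b (A : Vec X (suc n)) → P a (b ∷ A) ≡ (M a b ∧ det M A) xor ((M b b ∧ P a A) xor Q a b A)
    P-∷ {zero} a b (c ∷ []) = cong ((M a b ∧ M c c) xor_) (single (M a c) (M b b))
      where
      open xor-∧-Solver
      single : ∀ x y → x ∧ y ≡ (y ∧ (x ∧ true)) xor false
      single = solve 2 (λ x y → x :* y := (y :* (x :* con true)) :+ con false) refl
    P-∷ {suc n} a b A = trans (pick-∷ _ b A) (cong ((M a b ∧ det M A) xor_) (begin
      pick (λ c C → M a c ∧ det M (b ∷ C)) A
        ≡⟨ pick-cong A (λ {c} _ C → distribute (M a c) (M b b) (det M C) (P b C)) ⟩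
      pick (λ c C → (M b b ∧ (M a c ∧ det M C)) xor (M a c ∧ P b C)) A
        ≡⟨ pick-xor (λ c C → M b b ∧ (M a c ∧ det M C)) (λ c C → M a c ∧ P b C) A ⟩
      pick (λ c C → M b b ∧ (M a c ∧ det M C)) A xor pick (λ c C → M a c ∧ P b C) A
        ≡⟨ cong₂ _xor_ (pick-∧ (M b b) (λ c C → M a c ∧ det M C) A)
             (pick-cong A (λ {c} _ C → sym (pick-∧ (M a c) (λ d E → M b d ∧ det M E) C))) ⟩
      (M b b ∧ P a A) xor Q a b A ∎))
      where
      open ≡-Reasoning
      open xor-∧-Solver
      distribute : ∀ w x y z → w ∧ ((x ∧ y) xor z) ≡ (x ∧ (w ∧ y)) xor (w ∧ z)
      distribute = solve 4 (λ w x y z → w :* ((x :* y) :+ z) := (x :* (w :* y)) :+ (w :* z)) refl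

    det-swap : ∀ {n} a b (A : Vec X n) → det M (a ∷ b ∷ A) ≡ det M (b ∷ a ∷ A)
    det-swap {zero} a b [] = cong₂ _xor_ (∧-comm (M a a) (M b b)) (cong (_∧ true) (M-sym a b))
    det-swap {suc n} a b A = begin
      (M a a ∧ ((M b b ∧ det M A) xor P b A)) xor P a (b ∷ A)
        ≡⟨ cong ((M a a ∧ ((M b b ∧ det M A) xor P b A)) xor_) (P-∷ a b A) ⟩
      (M a a ∧ ((M b b ∧ det M A) xor P b A)) xor ((M a b ∧ det M A) xor ((M b b ∧ P a A) xor Q a b A))
        ≡⟨ symmetric (M a a) (M b b) (M a b) (det M A) (P a A) (P b A) (Q a b A) ⟩
      (M b b ∧ ((M a a ∧ det M A) xor P a A)) xor ((M a b ∧ det M A) xor ((M a a ∧ P b A) xor Q a b A))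
        ≡⟨ cong₂ (λ x y → (M b b ∧ ((M a a ∧ det M A) xor P a A)) xor ((x ∧ det M A) xor ((M a a ∧ P b A) xor y)))
             (M-sym a b) (Q-swap a b A) ⟩
      (M b b ∧ ((M a a ∧ det M A) xor P a A)) xor ((M b a ∧ det M A) xor ((M a a ∧ P b A) xor Q b a A))
        ≡⟨ cong ((M b b ∧ ((M a a ∧ det M A) xor P a A)) xor_) (P-∷ b a A) ⟨
      (M b b ∧ ((M a a ∧ det M A) xor P a A)) xor P b (a ∷ A) ∎
      where
      open ≡-Reasoning
      open xor-∧-Solver
      symmetric : ∀ u v w x p q r →
        (u ∧ ((v ∧ x) xor q)) xor ((w ∧ x) xor ((v ∧ p) xor r)) ≡
        (v ∧ ((u ∧ x) xor p)) xor ((w ∧ x) xor ((u ∧ q) xor r))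
      symmetric = solve 7 (λ u v w x p q r →
        (u :* ((v :* x) :+ q)) :+ ((w :* x) :+ ((v :* p) :+ r)) :=
        (v :* ((u :* x) :+ p)) :+ ((w :* x) :+ ((u :* q) :+ r))) refl

    det-~ : ∀ {n} {A B : Vec X n} → A ~ B → det M A ≡ det M B
    det-~ ~-refl = refl
    det-~ {suc zero}    (~-prep a {[]} {[]} p) = refl
    det-~ {suc (suc n)} (~-prep a p) = cong₂ (λ x y → (M a a ∧ x) xor y) (det-~ p)
      (pick-~ _ (λ b B~ → cong (M a b ∧_) (det-~ {n} B~)) p)
    det-~ (~-swap a b {A}) = det-swap a b A
    det-~ (~-trans p q) = trans (det-~ p) (det-~ q)

    -- Involutions fixing both copies of a cancel those that exchange them, as x ∧ x = x. If just
    -- one copy has a partner in A, the two choices of that copy cancel; if both have partners,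
    -- `Q-self` applies.
    det-repeated : ∀ {n} a (A : Vec X n) → det M (a ∷ a ∷ A) ≡ false
    det-repeated {zero} a [] = vanish (M a a)
      where
      vanish : ∀ x → (x ∧ x) xor (x ∧ true) ≡ false
      vanish false = refl
      vanish true  = refl
    det-repeated {suc n} a A = trans
      (cong ((M a a ∧ ((M a a ∧ det M A) xor P a A)) xor_)
        (trans (P-∷ a a A) (cong (λ q → (M a a ∧ det M A) xor ((M a a ∧ P a A) xor q)) (Q-self a A))))
      (vanish (M a a) (det M A) (P a A))
      where
      vanish : ∀ x y z → (x ∧ ((x ∧ y) xor z)) xor ((x ∧ y) xor ((x ∧ z) xor false)) ≡ false
      vanish false y z = refl
      vanish true  y z = trans (cong (λ t → (y xor z) xor (y xor t)) (xor-identityʳ z)) (xor-same (y xor z))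

    det-∈ : ∀ {n a} {A : Vec X (suc n)} → a ∈ A → det M (a ∷ A) ≡ false
    det-∈ {a = a} a∈A with ~-front a∈A
    ... | .a , B , refl , A~ = trans (det-~ (~-prep a A~)) (det-repeated a B)

    -- Since c x = 1, the relation expresses the entries M a x through the other columns. Off the
    -- diagonal this is linear in c. On the diagonal it yields the quadratic form Σ c_y c_z M y z,
    -- which modulo 2 is the linear form Σ c_y M y y. Therefore det (x ∷ B) is the sum of c_y det (y
    -- ∷ B) over y in B, and each summand repeats an index.
    det-dependent : ∀ {n} (A : Vec X n) (c : X → Bool) → Any (λ a → c a ≡ true) A →
      (∀ {a} → a ∈ A → sumᵥ (λ b → c b ∧ M a b) A ≡ false) → det M A ≡ false
    det-dependent {suc n} A c nonzero kernel with ~-front nonzero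
    ... | x , B , cx , A~ = trans (det-~ A~) (front B (λ {a} a∈ → trans (sym (sumᵥ-~ _ A~)) (kernel (~-∈ A~ a∈))))
      where
      front : ∀ {n} (B : Vec X n) → (∀ {a} → a ∈ x ∷ B → sumᵥ (λ b → c b ∧ M a b) (x ∷ B) ≡ false) →
        det M (x ∷ B) ≡ false
      front {zero} [] kernel = trans (sym (cong (_∧ M x x) cx)) (trans (sym (xor-identityʳ _)) (kernel (here refl)))
      front {suc n} B kernel = begin
        (M x x ∧ det M B) xor P x B
          ≡⟨ cong₂ (λ s p → (s ∧ det M B) xor p) (trans (row (here refl)) diagonal)
               (pick-cong B (λ {b} b∈B E → cong (_∧ det M E) (column b∈B))) ⟩
        (sumᵥ (λ y → c y ∧ M y y) B ∧ det M B) xor pick (λ b E → sumᵥ (λ y → c y ∧ M y b) B ∧ det M E) B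
          ≡⟨ linear B ⟩
        sumᵥ (λ y → c y ∧ det M (y ∷ B)) B
          ≡⟨ sumᵥ-cong B (λ {y} y∈B → trans (cong (c y ∧_) (det-∈ y∈B)) (∧-zeroʳ (c y))) ⟩
        sumᵥ (λ _ → false) B
          ≡⟨ sumᵥ-false B ⟩
        false ∎
        where
        open ≡-Reasoning
        row : ∀ {a} → a ∈ x ∷ B → M a x ≡ sumᵥ (λ b → c b ∧ M a b) B
        row {a} a∈ = xor≡false⇒≡ (M a x) _ (trans (cong (λ t → (t ∧ M a x) xor sumᵥ (λ b → c b ∧ M a b) B) (sym cx)) (kernel a∈))
        column : ∀ {b} → b ∈ B → M x b ≡ sumᵥ (λ y → c y ∧ M y b) B
        column {b} b∈B = trans (M-sym x b) (trans (row (there b∈B)) (sumᵥ-cong B (λ {y} _ → cong (c y ∧_) (M-sym b y))))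
        -- Terms at two distinct positions occur twice and cancel by symmetry; on the diagonal c y ∧
        -- c y = c y.
        trace : ∀ {m} (S : Vec X m) → sumᵥ (λ y → c y ∧ sumᵥ (λ z → c z ∧ M y z) S) S ≡ sumᵥ (λ y → c y ∧ M y y) S
        trace []      = refl
        trace (y ∷ S) = begin
          (c y ∧ ((c y ∧ M y y) xor r)) xor sumᵥ (λ w → c w ∧ ((c y ∧ M w y) xor sumᵥ (λ z → c z ∧ M w z) S)) S
            ≡⟨ cong ((c y ∧ ((c y ∧ M y y) xor r)) xor_) (begin
                 sumᵥ (λ w → c w ∧ ((c y ∧ M w y) xor sumᵥ (λ z → c z ∧ M w z) S)) S
                   ≡⟨ sumᵥ-cong S (λ {w} _ → trans
                          (cong (λ t → c w ∧ ((c y ∧ t) xor sumᵥ (λ z → c z ∧ M w z) S)) (M-sym w y))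
                          (split (c w) (c y) (M y w) (sumᵥ (λ z → c z ∧ M w z) S))) ⟩
                 sumᵥ (λ w → (c y ∧ (c w ∧ M y w)) xor (c w ∧ sumᵥ (λ z → c z ∧ M w z) S)) S
                   ≡⟨ sumᵥ-xor _ _ S ⟩
                 sumᵥ (λ w → c y ∧ (c w ∧ M y w)) S xor sumᵥ (λ w → c w ∧ sumᵥ (λ z → c z ∧ M w z) S) S
                   ≡⟨ cong₂ _xor_ (sumᵥ-∧ (c y) _ S) (trace S) ⟩
                 (c y ∧ r) xor sumᵥ (λ w → c w ∧ M w w) S ∎) ⟩
          (c y ∧ ((c y ∧ M y y) xor r)) xor ((c y ∧ r) xor sumᵥ (λ w → c w ∧ M w w) S)
            ≡⟨ cancel (c y) (M y y) r (sumᵥ (λ w → c w ∧ M w w) S) ⟩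
          (c y ∧ M y y) xor sumᵥ (λ w → c w ∧ M w w) S ∎
          where
          open xor-∧-Solver
          r = sumᵥ (λ z → c z ∧ M y z) S
          split : ∀ u v s t → u ∧ ((v ∧ s) xor t) ≡ (v ∧ (u ∧ s)) xor (u ∧ t)
          split = solve 4 (λ u v s t → u :* ((v :* s) :+ t) := (v :* (u :* s)) :+ (u :* t)) refl
          cancel : ∀ u m r s → (u ∧ ((u ∧ m) xor r)) xor ((u ∧ r) xor s) ≡ (u ∧ m) xor s
          cancel false m r s = refl
          cancel true  m r s = trans (xor-assoc m r (r xor s)) (cong (m xor_) (xor-cancelˡ r s))
        diagonal : sumᵥ (λ b → c b ∧ M x b) B ≡ sumᵥ (λ y → c y ∧ M y y) B
        diagonal = trans (sumᵥ-cong B (λ {y} y∈B → cong (c y ∧_) (trans (M-sym x y) (row (there y∈B))))) (trace B)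
        linear : ∀ {m} (S : Vec X m) →
          (sumᵥ (λ y → c y ∧ M y y) S ∧ det M B) xor pick (λ b E → sumᵥ (λ y → c y ∧ M y b) S ∧ det M E) B ≡
          sumᵥ (λ y → c y ∧ det M (y ∷ B)) S
        linear []      = pick-∧ false (λ _ _ → false) B
        linear (y ∷ S) = begin
          (((c y ∧ M y y) xor s) ∧ det M B) xor pick (λ b E → ((c y ∧ M y b) xor t b) ∧ det M E) B
            ≡⟨ cong ((((c y ∧ M y y) xor s) ∧ det M B) xor_) (begin
                 pick (λ b E → ((c y ∧ M y b) xor t b) ∧ det M E) B
                   ≡⟨ pick-cong B (λ {b} _ E → split (c y) (M y b) (t b) (det M E)) ⟩
                 pick (λ b E → (c y ∧ (M y b ∧ det M E)) xor (t b ∧ det M E)) B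
                   ≡⟨ pick-xor (λ b E → c y ∧ (M y b ∧ det M E)) (λ b E → t b ∧ det M E) B ⟩
                 pick (λ b E → c y ∧ (M y b ∧ det M E)) B xor pick (λ b E → t b ∧ det M E) B
                   ≡⟨ cong (_xor pick (λ b E → t b ∧ det M E) B) (pick-∧ (c y) _ B) ⟩
                 (c y ∧ P y B) xor pick (λ b E → t b ∧ det M E) B ∎) ⟩
          (((c y ∧ M y y) xor s) ∧ det M B) xor ((c y ∧ P y B) xor pick (λ b E → t b ∧ det M E) B)
            ≡⟨ regroup (c y) (M y y) s (det M B) (P y B) _ ⟩
          (c y ∧ ((M y y ∧ det M B) xor P y B)) xor ((s ∧ det M B) xor pick (λ b E → t b ∧ det M E) B)
            ≡⟨ cong ((c y ∧ det M (y ∷ B)) xor_) (linear S) ⟩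
          sumᵥ (λ y → c y ∧ det M (y ∷ B)) (y ∷ S) ∎
          where
          open xor-∧-Solver
          s = sumᵥ (λ y → c y ∧ M y y) S
          t = λ b → sumᵥ (λ y → c y ∧ M y b) S
          split : ∀ u v w z → ((u ∧ v) xor w) ∧ z ≡ (u ∧ (v ∧ z)) xor (w ∧ z)
          split = solve 4 (λ u v w z → ((u :* v) :+ w) :* z := (u :* (v :* z)) :+ (w :* z)) refl
          regroup : ∀ u v s z p q → (((u ∧ v) xor s) ∧ z) xor ((u ∧ p) xor q) ≡ (u ∧ ((v ∧ z) xor p)) xor ((s ∧ z) xor q)
          regroup = solve 6 (λ u v s z p q → (((u :* v) :+ s) :* z) :+ ((u :* p) :+ q) := (u :* ((v :* z) :+ p)) :+ ((s :* z) :+ q)) refl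

-- Counting points by polynomials of low degree

Degree< : ∀ {n} → ℕ → Poly n → Set
Degree< d = All (λ m → length m ℕ.< d)

-- The bound is strict so that `Low 0` means the zero function, which starts the induction on
-- leading terms of determinants.
Low : ∀ {n} → ℕ → (Vec Bool n → Bool) → Set
Low d f = ∃[ p ] (Degree< d p × (∀ x → evalPoly p x ≡ f x))

evalPoly-++ : ∀ {n} (p q : Poly n) x → evalPoly (p List.++ q) x ≡ evalPoly p x xor evalPoly q x
evalPoly-++ List.[]      q x = refl
evalPoly-++ (m List.∷ p) q x = trans (cong (evalMono m x xor_) (evalPoly-++ p q x))
  (sym (xor-assoc (evalMono m x) (evalPoly p x) (evalPoly q x)))

evalMono-++ : ∀ {n} (l m : Monomial n) x → evalMono (l List.++ m) x ≡ evalMono l x ∧ evalMono m x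
evalMono-++ List.[]      m x = refl
evalMono-++ (i List.∷ l) m x = trans (cong (lookup x i ∧_) (evalMono-++ l m x))
  (sym (∧-assoc (lookup x i) (evalMono l x) (evalMono m x)))

Low-cong : ∀ {d n} {f g : Vec Bool n → Bool} → (∀ x → f x ≡ g x) → Low d f → Low d g
Low-cong eq (p , deg , ev) = p , deg , λ x → trans (ev x) (eq x)

Low-≤ : ∀ {c d n} {f : Vec Bool n → Bool} → c ℕ.≤ d → Low c f → Low d f
Low-≤ c≤d (p , deg , ev) = p , All.map (λ l< → ℕₚ.≤-trans l< c≤d) deg , ev

Low-false : ∀ {d n} → Low {n} d (λ _ → false)
Low-false = List.[] , [] , λ _ → refl

Low-evalMono : ∀ {n} (m : Monomial n) → Low (suc (length m)) (evalMono m)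
Low-evalMono m = List.[ m ] , ℕₚ.≤-refl ∷ [] , λ x → xor-identityʳ (evalMono m x)

Low-xor : ∀ {d n} {f g : Vec Bool n → Bool} → Low d f → Low d g → Low d (λ x → f x xor g x)
Low-xor (p , dp , ep) (q , dq , eq) =
  p List.++ q , All.++⁺ dp dq , λ x → trans (evalPoly-++ p q x) (cong₂ _xor_ (ep x) (eq x))

Low-∧-evalMono : ∀ {d n} (m : Monomial n) {f : Vec Bool n → Bool} → Low d f →
  Low (length m ℕ.+ d) (λ x → evalMono m x ∧ f x)
Low-∧-evalMono {d} {n} m (p , dp , ep) =
  List.map (m List.++_) p , All.map⁺ (All.map bound dp) , λ x → trans (eval p x) (cong (evalMono m x ∧_) (ep x))
  where
  bound : ∀ {l} → length l ℕ.< d → length (m List.++ l) ℕ.< length m ℕ.+ d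
  bound {l} l<d = subst (ℕ._< length m ℕ.+ d) (sym (List.length-++ m)) (ℕₚ.+-monoʳ-< (length m) l<d)
  eval : ∀ p x → evalPoly (List.map (m List.++_) p) x ≡ evalMono m x ∧ evalPoly p x
  eval List.[]      x = sym (∧-zeroʳ (evalMono m x))
  eval (l List.∷ p) x = trans (cong₂ _xor_ (evalMono-++ m l x) (eval p x))
    (sym (∧-distribˡ-xor (evalMono m x) (evalMono l x) (evalPoly p x)))

Low-∧-lookup : ∀ {d n} (i : Fin n) {f : Vec Bool n → Bool} → Low d f → Low (suc d) (λ x → lookup x i ∧ f x)
Low-∧-lookup i {f} low = Low-cong (λ x → cong (_∧ f x) (∧-identityʳ (lookup x i))) (Low-∧-evalMono (i List.∷ List.[]) low)

Low-∧ : ∀ {c d n} {f g : Vec Bool n → Bool} → Low (suc c) f → Low d g → Low (c ℕ.+ d) (λ x → f x ∧ g x)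
Low-∧ {c} {d} {n} {f} {g} (p , dp , ep) low-g = Low-cong (λ x → cong (_∧ g x) (ep x)) (product p dp)
  where
  product : ∀ p → Degree< (suc c) p → Low (c ℕ.+ d) (λ x → evalPoly p x ∧ g x)
  product List.[]      []       = Low-false
  product (m List.∷ p) (l ∷ ls) = Low-cong (λ x → sym (∧-distribʳ-xor (g x) (evalMono m x) (evalPoly p x)))
    (Low-xor (Low-≤ (ℕₚ.+-monoˡ-≤ d (ℕ.s≤s⁻¹ l)) (Low-∧-evalMono m low-g)) (product p ls))

Low-tail : ∀ {d n} {f : Vec Bool n → Bool} → Low d f → Low d (f ∘ tail)
Low-tail {d} {n} (p , dp , ep) = List.map (List.map suc) p , All.map⁺ (All.map (λ {m} → bound m) dp) ,
  λ { (b ∷ x) → trans (evalP b p x) (ep x) }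
  where
  bound : ∀ (m : Monomial n) → length m ℕ.< d → length (List.map {B = Fin (suc n)} suc m) ℕ.< d
  bound m = subst (ℕ._< d) (sym (List.length-map suc m))
  evalM : ∀ b (m : Monomial n) x → evalMono (List.map suc m) (b ∷ x) ≡ evalMono m x
  evalM b List.[]      x = refl
  evalM b (i List.∷ m) x = cong (lookup x i ∧_) (evalM b m x)
  evalP : ∀ b (p : Poly n) x → evalPoly (List.map (List.map suc) p) (b ∷ x) ≡ evalPoly p x
  evalP b List.[]      x = refl
  evalP b (m List.∷ p) x = cong₂ _xor_ (evalM b m x) (evalP b p x)

Low-const : ∀ {d n} b → Low {n} (suc d) (λ _ → b)
Low-const false = Low-false
Low-const true  = Low-≤ (ℕ.s≤s ℕ.z≤n) (Low-evalMono List.[])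

Low-additive : ∀ {n} (f : Vec Bool n → Bool) → (∀ x y → f (x ⊕ y) ≡ f x xor f y) → Low 2 f
Low-additive {zero}  f add = Low-cong (λ { [] → sym (trans (add [] []) (xor-same (f []))) }) Low-false
Low-additive {suc n} f add = Low-cong recombine
  (Low-xor (Low-∧-lookup zero (Low-const (f (e zero))))
           (Low-tail (Low-additive (λ x → f (false ∷ x)) (λ x y → add (false ∷ x) (false ∷ y)))))
  where
  recombine : ∀ x → (lookup x zero ∧ f (e zero)) xor f (false ∷ tail x) ≡ f x
  recombine (false ∷ x) = refl
  recombine (true ∷ x)  = trans (sym (add (e zero) (false ∷ x))) (cong (λ y → f (true ∷ y)) (⊕-identityˡ x))

Low-any : ∀ {n} (f : Vec Bool n → Bool) → Low (suc n) f
Low-any {zero}  f = Low-cong (λ { [] → refl }) (Low-const (f []))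
Low-any {suc n} f = Low-cong recombine
  (Low-xor (Low-≤ (ℕₚ.n≤1+n (suc n)) (Low-tail (Low-any (λ x → f (false ∷ x)))))
           (Low-∧-lookup zero (Low-tail (Low-any (λ x → f (false ∷ x) xor f (true ∷ x))))))
  where
  recombine : ∀ x → f (false ∷ tail x) xor (lookup x zero ∧ (f (false ∷ tail x) xor f (true ∷ tail x))) ≡ f x
  recombine (false ∷ x) = xor-identityʳ (f (false ∷ x))
  recombine (true ∷ x)  = xor-cancelˡ (f (false ∷ x)) (f (true ∷ x))

Low-pick : ∀ {d N m} {X : Set} (f : Vec Bool N → X → Vec X m → Bool) →
  (∀ b B → Low d (λ h → f h b B)) → ∀ A → Low d (λ h → pick (f h) A)
Low-pick f low (a ∷ [])    = low a []
Low-pick f low (a ∷ b ∷ A) = Low-xor (low a (b ∷ A)) (Low-pick (λ h c C → f h c (a ∷ C)) (λ c C → low c (a ∷ C)) (b ∷ A))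

-- The binomial sum Σ_{i < d} C(n, i): by Pascal's rule, multilinear monomials without the first
-- variable and those with it.
monomials< : ℕ → ℕ → ℕ
monomials< n       zero    = 0
monomials< zero    (suc d) = 1
monomials< (suc n) (suc d) = monomials< n (suc d) ℕ.+ monomials< n d

-- Chernoff's bound: weighting monomials of degree i by 3^(d - 1 - i), at least 1 for i < d, gives
-- at most 3^(d - 1) (4/3)^n. The weight z = 1/3 is optimal for d = n / 4, where z / (1 + z) = 1/4.
monomials<-bound : ∀ n d → monomials< n d ℕ.* 3 ℕ.* 3 ℕ.^ n ℕ.≤ 3 ℕ.^ d ℕ.* 4 ℕ.^ n
monomials<-bound n       zero    = ℕ.z≤n
monomials<-bound zero    (suc d) = ℕₚ.≤-trans (ℕₚ.m≤m*n 3 (3 ℕ.^ d) {{ℕₚ.m^n≢0 3 d}}) (ℕₚ.≤-reflexive (sym (ℕₚ.*-identityʳ _)))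
monomials<-bound (suc n) (suc d) = begin
  (u ℕ.+ v) ℕ.* 3 ℕ.* (3 ℕ.* t)                      ≡⟨ split u v t ⟩
  3 ℕ.* (u ℕ.* 3 ℕ.* t) ℕ.+ 3 ℕ.* (v ℕ.* 3 ℕ.* t)    ≤⟨ ℕₚ.+-mono-≤ (ℕₚ.*-monoʳ-≤ 3 (monomials<-bound n (suc d))) (ℕₚ.*-monoʳ-≤ 3 (monomials<-bound n d)) ⟩
  3 ℕ.* (3 ℕ.* w ℕ.* q) ℕ.+ 3 ℕ.* (w ℕ.* q)          ≡⟨ join w q ⟩
  3 ℕ.* w ℕ.* (4 ℕ.* q)                              ∎
  where
  open ℕₚ.≤-Reasoning
  u = monomials< n (suc d)
  v = monomials< n d
  t = 3 ℕ.^ n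
  w = 3 ℕ.^ d
  q = 4 ℕ.^ n
  split : ∀ u v t → (u ℕ.+ v) ℕ.* 3 ℕ.* (3 ℕ.* t) ≡ 3 ℕ.* (u ℕ.* 3 ℕ.* t) ℕ.+ 3 ℕ.* (v ℕ.* 3 ℕ.* t)
  split = ℕ-Ring.solve-∀
  join : ∀ w q → 3 ℕ.* (3 ℕ.* w ℕ.* q) ℕ.+ 3 ℕ.* (w ℕ.* q) ≡ 3 ℕ.* w ℕ.* (4 ℕ.* q)
  join = ℕ-Ring.solve-∀

-- Coefficients of multilinear polynomials of degree below d. Unlike `Poly`, where monomials and
-- variables may repeat, this form is finite and can be counted through `flatten`.
Coeffs : ℕ → ℕ → Set
Coeffs n       zero    = ⊤
Coeffs zero    (suc d) = Bool
Coeffs (suc n) (suc d) = Coeffs n (suc d) × Coeffs n d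

eval : ∀ n d → Coeffs n d → Vec Bool n → Bool
eval n       zero    c       x       = false
eval zero    (suc d) b       x       = b
eval (suc n) (suc d) (p , q) (b ∷ x) = eval n (suc d) p x xor (b ∧ eval n d q x)

flatten : ∀ n d → Coeffs n d → Vec Bool (monomials< n d)
flatten n       zero    c       = []
flatten zero    (suc d) b       = b ∷ []
flatten (suc n) (suc d) (p , q) = flatten n (suc d) p ++ flatten n d q

flatten-injective : ∀ n d (p q : Coeffs n d) → flatten n d p ≡ flatten n d q → p ≡ q
flatten-injective n       zero    p        q        eq   = refl
flatten-injective zero    (suc d) p        .p       refl = refl
flatten-injective (suc n) (suc d) (p , p′) (q , q′) eq   = cong₂ _,_
  (flatten-injective n (suc d) p q (++-injectiveˡ (flatten n (suc d) p) (flatten n (suc d) q) eq))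
  (flatten-injective n d p′ q′ (++-injectiveʳ (flatten n (suc d) p) (flatten n (suc d) q) eq))

Represented : ∀ {n} → ℕ → (Vec Bool n → Bool) → Set
Represented {n} d f = ∃[ c ] (∀ x → eval n d c x ≡ f x)

represent-false : ∀ n d → Represented {n} d (λ _ → false)
represent-false n       zero    = tt , λ _ → refl
represent-false zero    (suc d) = false , λ _ → refl
represent-false (suc n) (suc d) with represent-false n (suc d) | represent-false n d
... | p , ep | q , eq = (p , q) , λ { (b ∷ x) → cong₂ _xor_ (ep x) (trans (cong (b ∧_) (eq x)) (∧-zeroʳ b)) }

represent-xor : ∀ n d {f g : Vec Bool n → Bool} → Represented d f → Represented d g → Represented d (λ x → f x xor g x)
represent-xor n d (p , ep) (q , eq) = plus n d p q , λ x → trans (eval-plus n d p q x) (cong₂ _xor_ (ep x) (eq x))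
  where
  plus : ∀ n d → Coeffs n d → Coeffs n d → Coeffs n d
  plus n       zero    p        q        = tt
  plus zero    (suc d) p        q        = p xor q
  plus (suc n) (suc d) (p , p′) (q , q′) = plus n (suc d) p q , plus n d p′ q′
  eval-plus : ∀ n d p q x → eval n d (plus n d p q) x ≡ eval n d p x xor eval n d q x
  eval-plus n       zero    p        q        x       = refl
  eval-plus zero    (suc d) p        q        x       = refl
  eval-plus (suc n) (suc d) (p , p′) (q , q′) (b ∷ x) = trans
    (cong₂ (λ u v → u xor (b ∧ v)) (eval-plus n (suc d) p q x) (eval-plus n d p′ q′ x))
    (regroup (eval n (suc d) p x) (eval n (suc d) q x) b (eval n d p′ x) (eval n d q′ x))
    where
    regroup : ∀ s t b u v → (s xor t) xor (b ∧ (u xor v)) ≡ (s xor (b ∧ u)) xor (t xor (b ∧ v))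
    regroup s t b u v = trans (cong ((s xor t) xor_) (∧-distribˡ-xor b u v)) (xor-interchange s t (b ∧ u) (b ∧ v))

represent-suc : ∀ n d {f : Vec Bool n → Bool} → Represented d f → Represented (suc d) f
represent-suc n d (c , ec) = raise n d c , λ x → trans (eval-raise n d c x) (ec x)
  where
  raise : ∀ n d → Coeffs n d → Coeffs n (suc d)
  raise n       zero    c       = proj₁ (represent-false n 1)
  raise zero    (suc d) c       = c
  raise (suc n) (suc d) (p , q) = raise n (suc d) p , raise n d q
  eval-raise : ∀ n d c x → eval n (suc d) (raise n d c) x ≡ eval n d c x
  eval-raise n       zero    c       x       = proj₂ (represent-false n 1) x
  eval-raise zero    (suc d) c       x       = refl
  eval-raise (suc n) (suc d) (p , q) (b ∷ x) =
    cong₂ (λ u v → u xor (b ∧ v)) (eval-raise n (suc d) p x) (eval-raise n d q x)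

represent-lookup : ∀ n d (i : Fin n) {f : Vec Bool n → Bool} → Represented d f →
  Represented (suc d) (λ x → lookup x i ∧ f x)
represent-lookup n zero i {f} (c , ec) with represent-false n 1
... | p , ep = p , λ x → trans (ep x) (sym (trans (cong (lookup x i ∧_) (sym (ec x))) (∧-zeroʳ (lookup x i))))
-- As x₀² = x₀, the product x₀ (p + x₀ q) is x₀ (p + q): the part free of x₀ becomes zero, and q is
-- raised one degree to be added to p.
represent-lookup (suc n) (suc d) zero {f} ((p , q) , ec)
  with represent-false n (suc (suc d)) | represent-xor n (suc d) (p , λ _ → refl) (represent-suc n d (q , λ _ → refl))
... | z , ez | s , es = (z , s) , λ
  { (b ∷ x) → trans (cong₂ (λ u v → u xor (b ∧ v)) (ez x) (es x)) (trans (idem b (eval n (suc d) p x) (eval n d q x)) (cong (b ∧_) (ec (b ∷ x)))) }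
  where
  idem : ∀ b u v → b ∧ (u xor v) ≡ b ∧ (u xor (b ∧ v))
  idem false u v = refl
  idem true  u v = refl
represent-lookup (suc n) (suc d) (suc i) {f} ((p , q) , ec)
  with represent-lookup n (suc d) i (p , λ _ → refl) | represent-lookup n d i (q , λ _ → refl)
... | p′ , ep | q′ , eq = (p′ , q′) , λ
  { (b ∷ x) → trans (cong₂ (λ u v → u xor (b ∧ v)) (ep x) (eq x))
      (trans (factor (lookup x i) (eval n (suc d) p x) b (eval n d q x)) (cong (lookup x i ∧_) (ec (b ∷ x)))) }
  where
  factor : ∀ l u b v → (l ∧ u) xor (b ∧ (l ∧ v)) ≡ l ∧ (u xor (b ∧ v))
  factor false u b v = ∧-zeroʳ b
  factor true  u b v = refl

represent-evalMono : ∀ {n d} (m : Monomial n) → length m ℕ.< d → Represented d (evalMono m)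
represent-evalMono {zero}  {suc d} List.[] l = true , λ _ → refl
represent-evalMono {suc n} {suc d} List.[] l with represent-evalMono {n} {suc d} List.[] l | represent-false n d
... | p , ep | q , eq = (p , q) , λ { (b ∷ x) → cong₂ _xor_ (ep x) (trans (cong (b ∧_) (eq x)) (∧-zeroʳ b)) }
represent-evalMono {n} {suc d} (i List.∷ m) (ℕ.s≤s l) = represent-lookup n d i (represent-evalMono m l)

represent-evalPoly : ∀ {n d} (p : Poly n) → Degree< d p → Represented d (evalPoly p)
represent-evalPoly {n} {d} List.[]      []       = represent-false n d
represent-evalPoly {n} {d} (m List.∷ p) (l ∷ ls) =
  represent-xor n d (represent-evalMono m l) (represent-evalPoly p ls)

-- The function supported on S with the values on S listed in v. There are 2^(count S) such
-- functions.
extend : ∀ {n} (S : Vec Bool n → Bool) → Vec Bool (count S) → Vec Bool n → Bool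
extend {zero}  S v []          = value (S []) v
  where
  value : ∀ b → Vec Bool (indicator b) → Bool
  value true  (c ∷ []) = c
  value false []       = false
extend {suc n} S v (false ∷ x) = extend (S ∘ (false ∷_)) (take (count (S ∘ (false ∷_))) v) x
extend {suc n} S v (true ∷ x)  = extend (S ∘ (true ∷_)) (drop (count (S ∘ (false ∷_))) v) x

extend-injective : ∀ {n} (S : Vec Bool n → Bool) v w →
  (∀ x → S x ≡ true → extend S v x ≡ extend S w x) → v ≡ w
extend-injective {zero} S v w eq = determined (S []) v w (eq [])
  where
  determined : ∀ b (v w : Vec Bool (indicator b)) →
    (b ≡ true → extend {zero} (λ _ → b) v [] ≡ extend {zero} (λ _ → b) w []) → v ≡ w
  determined true  (b ∷ []) (c ∷ []) eq = cong (_∷ []) (eq refl)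
  determined false []       []        eq = refl
extend-injective {suc n} S v w eq = begin
  v                    ≡⟨ take++drop≡id k v ⟨
  take k v ++ drop k v ≡⟨ cong₂ _++_ (extend-injective (S ∘ (false ∷_)) _ _ (eq ∘ (false ∷_)))
                                     (extend-injective (S ∘ (true ∷_)) _ _ (eq ∘ (true ∷_))) ⟩
  take k w ++ drop k w ≡⟨ take++drop≡id k w ⟩
  w                    ∎
  where
  open ≡-Reasoning
  k = count (S ∘ (false ∷_))

LowOn : ∀ {n} → (Vec Bool n → Bool) → ℕ → (Vec Bool n → Bool) → Set
LowOn S d f = ∃[ g ] (Low d g × (∀ x → S x ≡ true → g x ≡ f x))

-- The 2^(count S) functions on S are told apart by the coefficients of the polynomials that agree
-- with them there, so they inject into the 2^(monomials< n d) coefficient vectors.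
count≤monomials< : ∀ {n} (S : Vec Bool n → Bool) d → (∀ f → LowOn S d f) → count S ℕ.≤ monomials< n d
count≤monomials< {n} S d low = injection⇒≤ (flatten n d ∘ coeffs) λ v w eq →
  extend-injective S v w λ x Sx → trans (sym (agree v x Sx))
    (trans (cong (λ c → eval n d c x) (flatten-injective n d (coeffs v) (coeffs w) eq)) (agree w x Sx))
  where
  polynomial : ∀ v → ∃[ c ] (∀ x → S x ≡ true → eval n d c x ≡ extend S v x)
  polynomial v with low (extend S v)
  ... | g , (p , deg , ev) , on with represent-evalPoly p deg
  ... | c , ec = c , λ x Sx → trans (ec x) (trans (ev x) (on x Sx))
  coeffs : Vec Bool (count S) → Coeffs n d
  coeffs = proj₁ ∘ polynomial
  agree : ∀ v x → S x ≡ true → eval n d (coeffs v) x ≡ extend S v x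
  agree = proj₂ ∘ polynomial

-- The set of h where all principal minors of order d vanish

search : ∀ {N} d (P : Vec (Fin N) d → Bool) → Dec (∃[ A ] P A ≡ true)
search zero    P = map′ (λ eq → [] , eq) (λ { ([] , eq) → eq }) (P [] Bool.≟ true)
search (suc d) P = map′ (λ { (a , A , eq) → a ∷ A , eq }) (λ { (a ∷ A , eq) → a , A , eq })
  (any? (λ a → search d (P ∘ (a ∷_))))

toList-take-drop : ∀ {X : Set} d (m : List.List X) → d ℕ.≤ length m →
  ∃[ A ] ∃[ l ] (m ≡ toList {n = d} A List.++ l × length m ≡ d ℕ.+ length l)
toList-take-drop zero    m            _         = [] , m , refl , refl
toList-take-drop (suc d) (a List.∷ m) (ℕ.s≤s p) with toList-take-drop d m p
... | A , l , refl , eq = a ∷ A , l , refl , cong suc eq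

pick-map : ∀ {X Y : Set} {n} (f : Y → Vec Y n → Bool) (g : X → Y) A →
  pick (λ a B → f (g a) (Vec.map g B)) A ≡ pick f (Vec.map g A)
pick-map f g (a ∷ [])    = refl
pick-map f g (a ∷ b ∷ A) = cong (f (g a) (Vec.map g (b ∷ A)) xor_) (pick-map (λ c C → f c (g a ∷ C)) g (b ∷ A))

det-map : ∀ {X Y : Set} {n} (M : Y → Y → Bool) (g : X → Y) (A : Vec X n) →
  det (λ a b → M (g a) (g b)) A ≡ det M (Vec.map g A)
det-map {n = zero}        M g []       = refl
det-map {n = suc zero}    M g (a ∷ []) = refl
det-map {n = suc (suc n)} M g (a ∷ A)  = cong₂ (λ u v → (M (g a) (g a) ∧ u) xor v) (det-map M g A)
  (trans (pick-cong A (λ {b} _ B → cong (M (g a) (g b) ∧_) (det-map {n = n} M g B)))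
         (pick-map (λ b B → M (g a) b ∧ det M B) g A))

module Degenerate {N : ℕ} (M : Vec Bool N → Fin N → Fin N → Bool)
  (M-sym : ∀ h a b → M h a b ≡ M h b a)
  (M-additive : ∀ h h′ a b → M (h ⊕ h′) a b ≡ M h a b xor M h′ a b)
  (M-diagonal : ∀ h a → M h a a ≡ lookup h a) (d : ℕ) where

  -- The minors range over all index vectors of length d, repetitions included, because a `Monomial`
  -- may repeat a variable.
  S : Vec Bool N → Bool
  S h = not ⌊ search d (det (M h)) ⌋

  S⇒det≡false : ∀ h → S h ≡ true → ∀ A → det (M h) A ≡ false
  S⇒det≡false h Sh A with search d (det (M h))
  S⇒det≡false h Sh A | no none = ¬-not (λ eq → none (A , eq))

  S⇒det≡true : ∀ h → S h ≡ false → ∃[ A ] det {n = d} (M h) A ≡ true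
  S⇒det≡true h ¬Sh with search d (det (M h))
  S⇒det≡true h ¬Sh | yes found = found

  -- Pairing two of the m indices contributes a single linear form, so the product of the diagonal
  -- entries is the only term of degree m.
  det-leading : ∀ {m} (A : Vec (Fin N) m) → Low m (λ h → det (M h) A xor evalMono (toList A) h)
  Low-det : ∀ {m} (A : Vec (Fin N) m) → Low (suc m) (λ h → det (M h) A)

  det-leading {zero}     []       = Low-false
  det-leading {suc zero} (a ∷ []) = Low-cong
    (λ h → sym (trans (cong₂ _xor_ (M-diagonal h a) (∧-identityʳ (lookup h a))) (xor-same (lookup h a)))) Low-false
  det-leading {suc (suc m)} (a ∷ A) = Low-cong regroup
    (Low-xor (Low-∧-lookup a (det-leading A))
             (Low-pick (λ h b B → M h a b ∧ det (M h) B)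
               (λ b B → Low-∧ {1} (Low-additive (λ h → M h a b) (λ h h′ → M-additive h h′ a b)) (Low-det B)) A))
    where
    regroup : ∀ h → (lookup h a ∧ (det (M h) A xor evalMono (toList A) h)) xor pick (λ b B → M h a b ∧ det (M h) B) A
      ≡ det (M h) (a ∷ A) xor evalMono (toList (a ∷ A)) h
    regroup h = trans (lemma (lookup h a) (det (M h) A) (evalMono (toList A) h) p)
      (cong (λ x → ((x ∧ det (M h) A) xor p) xor (lookup h a ∧ evalMono (toList A) h)) (sym (M-diagonal h a)))
      where
      p = pick (λ b B → M h a b ∧ det (M h) B) A
      lemma : ∀ x u v p → (x ∧ (u xor v)) xor p ≡ ((x ∧ u) xor p) xor (x ∧ v)
      lemma false u v p = sym (xor-identityʳ p)
      lemma true  u v p = trans (xor-assoc u v p) (trans (cong (u xor_) (xor-comm v p)) (sym (xor-assoc u p v)))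

  Low-det {m} A = Low-cong
    (λ h → trans (xor-comm _ (evalMono (toList A) h)) (trans (cong (evalMono (toList A) h xor_) (xor-comm (det (M h) A) _))
       (xor-cancelˡ (evalMono (toList A) h) (det (M h) A))))
    (Low-xor (Low-≤ (ℕₚ.n≤1+n m) (det-leading A))
             (subst (λ k → Low (suc k) (evalMono (toList A))) (length-toList A) (Low-evalMono (toList A))))
    where
    length-toList : ∀ {m} (A : Vec (Fin N) m) → length (toList A) ≡ m
    length-toList []      = refl
    length-toList (a ∷ A) = cong suc (length-toList A)

  -- Here k bounds the excess of the degree over d. On S a product of d variables equals its
  -- difference from the vanishing minor, which has degree below d. Substituting this for the first
  -- d factors of a long monomial and multiplying by the rest lowers the degree, and k drops by one.
  reduce : ∀ k (p : Poly N) → Degree< (k ℕ.+ d) p → LowOn S d (evalPoly p)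
  reduceMono : ∀ k (m : Monomial N) → length m ℕ.< k ℕ.+ d → LowOn S d (evalMono m)

  reduce k List.[]      []       = _ , Low-false , λ _ _ → refl
  reduce k (m List.∷ p) (l ∷ ls) with reduceMono k m l | reduce k p ls
  ... | f , lf , ef | g , lg , eg = _ , Low-xor lf lg , λ x Sx → cong₂ _xor_ (ef x Sx) (eg x Sx)

  reduceMono zero    m l = evalMono m , Low-≤ l (Low-evalMono m) , λ _ _ → refl
  reduceMono (suc k) m (ℕ.s≤s l) with length m ℕₚ.<? d
  ... | yes m<d = reduceMono zero m m<d
  ... | no m≮d with toList-take-drop d m (ℕₚ.≮⇒≥ m≮d)
  ... | A , r , refl , len with Low-≤ (ℕₚ.≤-trans (ℕₚ.≤-reflexive (trans (ℕₚ.+-comm (length r) d) (sym len))) l)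
                                  (Low-∧-evalMono r (det-leading A))
  ... | p , deg , ev with reduce k p deg
  ... | f , low , on = f , low , λ x Sx → trans (on x Sx) (trans (ev x) (begin
    evalMono r x ∧ (det (M x) A xor evalMono (toList A) x)
      ≡⟨ cong (λ b → evalMono r x ∧ (b xor evalMono (toList A) x)) (S⇒det≡false x Sx A) ⟩
    evalMono r x ∧ evalMono (toList A) x
      ≡⟨ ∧-comm (evalMono r x) (evalMono (toList A) x) ⟩
    evalMono (toList A) x ∧ evalMono r x
      ≡⟨ evalMono-++ (toList A) r x ⟨
    evalMono (toList A List.++ r) x ∎))
    where open ≡-Reasoning

  count-S : count S ℕ.≤ monomials< N d
  count-S = count≤monomials< S d reduced
    where
    reduced : ∀ f → LowOn S d f
    reduced f with Low-any f
    ... | p , deg , ev with reduce (suc N) p (All.map (λ l → ℕₚ.≤-trans l (ℕₚ.m≤m+n (suc N) d)) deg)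
    ... | g , low , on = g , low , λ x Sx → trans (on x Sx) (ev x)

-- Kernels of the matrices M_h and the number of bad pairs

comb : ∀ {N m} → Vec (Fin N) m → Vec Bool m → Vec Bool N
comb []      []          = 𝟎
comb (a ∷ A) (true ∷ c)  = e a ⊕ comb A c
comb (a ∷ A) (false ∷ c) = comb A c

⊕-interchange : ∀ {n} (w x y z : Vec Bool n) → (w ⊕ x) ⊕ (y ⊕ z) ≡ (w ⊕ y) ⊕ (x ⊕ z)
⊕-interchange []      []      []      []      = refl
⊕-interchange (a ∷ w) (b ∷ x) (c ∷ y) (d ∷ z) = cong₂ _∷_ (xor-interchange a b c d) (⊕-interchange w x y z)

⊕-injective : ∀ {n} (x y : Vec Bool n) → x ⊕ y ≡ 𝟎 → x ≡ y
⊕-injective x y eq = trans (sym (⊕-identityʳ x)) (trans (cong (x ⊕_) (sym eq)) (⊕-cancelˡ x y))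

comb-⊕ : ∀ {N m} (A : Vec (Fin N) m) c c′ → comb A (c ⊕ c′) ≡ comb A c ⊕ comb A c′
comb-⊕ []      []          []           = sym (⊕-self 𝟎)
comb-⊕ (a ∷ A) (false ∷ c) (false ∷ c′) = comb-⊕ A c c′
comb-⊕ (a ∷ A) (true ∷ c)  (false ∷ c′) = trans (cong (e a ⊕_) (comb-⊕ A c c′)) (sym (⊕-assoc (e a) (comb A c) (comb A c′)))
comb-⊕ (a ∷ A) (false ∷ c) (true ∷ c′)  = trans (cong (e a ⊕_) (trans (comb-⊕ A c c′) (⊕-comm (comb A c) (comb A c′))))
  (trans (sym (⊕-assoc (e a) (comb A c′) (comb A c))) (⊕-comm (e a ⊕ comb A c′) (comb A c)))
comb-⊕ (a ∷ A) (true ∷ c)  (true ∷ c′)  = trans (comb-⊕ A c c′)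
  (trans (sym (⊕-identityˡ _)) (trans (cong (_⊕ (comb A c ⊕ comb A c′)) (sym (⊕-self (e a))))
    (⊕-interchange (e a) (e a) (comb A c) (comb A c′))))

zero-or-nonzero : ∀ {X : Set} {m} (A : Vec X m) c → c ≡ 𝟎 ⊎ Any (λ p → proj₂ p ≡ true) (zip A c)
zero-or-nonzero []      []          = inj₁ refl
zero-or-nonzero (a ∷ A) (true ∷ c)  = inj₂ (here refl)
zero-or-nonzero (a ∷ A) (false ∷ c) with zero-or-nonzero A c
... | inj₁ eq = inj₁ (cong (false ∷_) eq)
... | inj₂ i  = inj₂ (there i)

module Kernels where
  open import Data.Integer using (ℤ; +_; +≤+; _+_; _*_; _≤_; 0ℤ; 1ℤ)
  open import Data.Integer.Properties
  open import Data.Integer.Tactic.RingSolver using (solve-∀)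

  module KernelCount {N : ℕ} (Φ : Vec Bool N → Vec Bool N → Vec Bool N → Bool)
    (additive₁ : ∀ h h′ k l → Φ (h ⊕ h′) k l ≡ Φ h k l xor Φ h′ k l)
    (additive₂ : ∀ h k k′ l → Φ h (k ⊕ k′) l ≡ Φ h k l xor Φ h k′ l)
    (swapʳ : ∀ h k l → Φ h k l ≡ Φ h l k)
    (diagonal : ∀ h a → Φ h (e a) (e a) ≡ lookup h a) (d : ℕ) where

    M : Vec Bool N → Fin N → Fin N → Bool
    M h a b = Φ h (e a) (e b)

    open Degenerate M (λ h a b → swapʳ h (e a) (e b)) (λ h h′ a b → additive₁ h h′ (e a) (e b)) diagonal d

    -- Membership of k in the kernel of M_h, tested on basis vectors. A basis vector that fails the
    -- test is itself the translation that flips the phase.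
    W : Vec Bool N → Vec Bool N → Bool
    W h k = not ⌊ any? (λ a → Φ h k (e a) Bool.≟ true) ⌋

    W≡true⇒ : ∀ h k → W h k ≡ true → ∀ a → Φ h k (e a) ≡ false
    W≡true⇒ h k eq a with any? (λ a → Φ h k (e a) Bool.≟ true)
    W≡true⇒ h k eq a | no none = ¬-not (λ p → none (a , p))

    W≡false⇒ : ∀ h k → W h k ≡ false → ∃[ a ] Φ h k (e a) ≡ true
    W≡false⇒ h k eq with any? (λ a → Φ h k (e a) Bool.≟ true)
    W≡false⇒ h k eq | yes found = found

    Φ-comb : ∀ {m} h (A : Vec (Fin N) m) c a → Φ h (comb A c) (e a) ≡ sumᵥ (λ p → proj₂ p ∧ M h a (proj₁ p)) (zip A c)
    Φ-comb h []      []          a = trans (cong (λ z → Φ h z (e a)) (sym (⊕-self 𝟎)))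
      (trans (additive₂ h 𝟎 𝟎 (e a)) (xor-same (Φ h 𝟎 (e a))))
    Φ-comb h (b ∷ A) (true ∷ c)  a = trans (additive₂ h (e b) (comb A c) (e a))
      (cong₂ _xor_ (swapʳ h (e b) (e a)) (Φ-comb h A c a))
    Φ-comb h (b ∷ A) (false ∷ c) a = Φ-comb h A c a

    -- In `det-dependent` coefficients are a function of the label, whereas A may repeat an index
    -- with different coefficients. The labels are therefore pairs of an index and its coefficient,
    -- and `det-map` forgets the coefficients.
    nonsingular : ∀ {m} h (A : Vec (Fin N) m) → det (M h) A ≡ true →
      ∀ c → (∀ a → Φ h (comb A c) (e a) ≡ false) → c ≡ 𝟎
    nonsingular h A det≡true c kernel with zero-or-nonzero A c
    ... | inj₁ eq      = eq
    ... | inj₂ nonzero = contradiction (trans (sym det≡true) (begin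
      det (M h) A                                               ≡⟨ cong (det (M h)) (map-proj₁-zip A c) ⟨
      det (M h) (Vec.map proj₁ (zip A c))                       ≡⟨ det-map (M h) proj₁ (zip A c) ⟨
      det (λ p q → M h (proj₁ p) (proj₁ q)) (zip A c)           ≡⟨ det-dependent (zip A c) proj₂ nonzero
                                                                     (λ {p} _ → trans (sym (Φ-comb h A c (proj₁ p))) (kernel (proj₁ p))) ⟩
      false                                                     ∎)) λ ()
      where
      open ≡-Reasoning
      open Det (λ p q → M h (proj₁ p) (proj₁ q)) (λ p q → swapʳ h (e (proj₁ p)) (e (proj₁ q)))

    #ker : Vec Bool N → ℤ
    #ker h = ∑ (λ k → ⟦ W h k ⟧)

    -- The 2^d translates of the kernel by `comb A c` are pairwise disjoint: if k ⊕ comb A c and k ⊕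
    -- comb A c′ both lie in the kernel, so does comb A (c ⊕ c′), and the nonzero minor forces c =
    -- c′.
    #ker-bound : ∀ h → S h ≡ false → 2^ d * #ker h ≤ 2^ N
    #ker-bound h ¬Sh with S⇒det≡true h ¬Sh
    ... | A , det≡true = begin
      2^ d * #ker h                                        ≡⟨ ∑-const {d} (#ker h) ⟨
      ∑ {d} (λ c → #ker h)                                 ≡⟨ ∑-cong (λ c → sym (∑-shift (comb A c) (λ k → ⟦ W h k ⟧))) ⟩
      ∑ (λ c → ∑ (λ k → ⟦ W h (k ⊕ comb A c) ⟧))           ≡⟨ ∑-swap (λ c k → ⟦ W h (k ⊕ comb A c) ⟧) ⟩
      ∑ (λ k → ∑ (λ c → ⟦ W h (k ⊕ comb A c) ⟧))           ≤⟨ ∑-mono (λ k → ∑⟦⟧≤1 (λ c → W h (k ⊕ comb A c)) (unique k)) ⟩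
      ∑ {N} (λ k → 1ℤ)                                     ≡⟨ trans (∑-const {N} 1ℤ) (*-identityʳ (2^ N)) ⟩
      2^ N                                                 ∎
      where
      open ≤-Reasoning
      unique : ∀ k c c′ → W h (k ⊕ comb A c) ≡ true → W h (k ⊕ comb A c′) ≡ true → c ≡ c′
      unique k c c′ Wc Wc′ = ⊕-injective c c′ (nonsingular h A det≡true (c ⊕ c′) λ a →
        trans (cong (λ z → Φ h z (e a)) (trans (comb-⊕ A c c′) (sym (translate (comb A c) (comb A c′)))))
          (trans (additive₂ h (k ⊕ comb A c) (k ⊕ comb A c′) (e a))
            (cong₂ _xor_ (W≡true⇒ h _ Wc a) (W≡true⇒ h _ Wc′ a))))
        where
        translate : ∀ x y → (k ⊕ x) ⊕ (k ⊕ y) ≡ x ⊕ y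
        translate x y = trans (⊕-interchange k x k y) (trans (cong (_⊕ (x ⊕ y)) (⊕-self k)) (⊕-identityˡ (x ⊕ y)))

    -- Rows h in S are few by `count-S` and get the trivial bound 2^N; the other rows get
    -- `#ker-bound`. The factor 2^d on the left avoids a division.
    #W-bound : 2^ d * ∑ #ker ≤ + (2 ℕ.^ N ℕ.* (2 ℕ.^ d ℕ.* monomials< N d) ℕ.+ 2 ℕ.^ N ℕ.* 2 ℕ.^ N)
    #W-bound = begin
      2^ d * ∑ #ker
        ≡⟨ ∑-*ˡ (2^ d) #ker ⟨
      ∑ (λ h → 2^ d * #ker h)
        ≤⟨ ∑-mono row ⟩
      ∑ (λ h → 2^ N * (2^ d * ⟦ S h ⟧) + 2^ N)
        ≡⟨ ∑-+ (λ h → 2^ N * (2^ d * ⟦ S h ⟧)) (λ _ → 2^ N) ⟩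
      ∑ (λ h → 2^ N * (2^ d * ⟦ S h ⟧)) + ∑ {N} (λ _ → 2^ N)
        ≡⟨ cong₂ _+_ (trans (∑-*ˡ (2^ N) (λ h → 2^ d * ⟦ S h ⟧)) (cong (2^ N *_) (trans (∑-*ˡ (2^ d) (⟦_⟧ ∘ S)) (cong (2^ d *_) (sym (count≡∑ S))))))
                     (∑-const {N} (2^ N)) ⟩
      2^ N * (2^ d * + count S) + 2^ N * 2^ N
        ≤⟨ +-monoˡ-≤ (2^ N * 2^ N) (*-monoˡ-≤-nonNeg (2^ N) (*-monoˡ-≤-nonNeg (2^ d) (+≤+ count-S))) ⟩
      2^ N * (2^ d * + monomials< N d) + 2^ N * 2^ N
        ≡⟨ cong₂ _+_ (trans (cong (2^ N *_) (sym (pos-* (2 ℕ.^ d) (monomials< N d)))) (sym (pos-* (2 ℕ.^ N) _))) (sym (pos-* (2 ℕ.^ N) (2 ℕ.^ N))) ⟩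
      + (2 ℕ.^ N ℕ.* (2 ℕ.^ d ℕ.* monomials< N d) ℕ.+ 2 ℕ.^ N ℕ.* 2 ℕ.^ N) ∎
      where
      open ≤-Reasoning
      row : ∀ h → 2^ d * #ker h ≤ 2^ N * (2^ d * ⟦ S h ⟧) + 2^ N
      row h with S h in eq
      ... | false = ≤-trans (#ker-bound h eq) (≤-reflexive (sym (vanish (2^ N) (2^ d))))
        where
        vanish : ∀ x y → x * (y * 0ℤ) + x ≡ x
        vanish = solve-∀
      ... | true = begin
        2^ d * #ker h                  ≤⟨ *-monoˡ-≤-nonNeg (2^ d) (∑-mono (λ k → ⟦⟧≤1 (W h k))) ⟩
        2^ d * ∑ {N} (λ k → 1ℤ)        ≡⟨ cong (2^ d *_) (∑-const {N} 1ℤ) ⟩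
        2^ d * (2^ N * 1ℤ)             ≡⟨ exchange (2^ d) (2^ N) ⟩
        2^ N * (2^ d * 1ℤ)             ≤⟨ i≤i+j _ (2^ N) ⟩
        2^ N * (2^ d * 1ℤ) + 2^ N      ∎
        where
        exchange : ∀ x y → x * (y * 1ℤ) ≡ y * (x * 1ℤ)
        exchange = solve-∀

open Kernels

-- From the fourth moment to an explicit exponential rate

module Numerics where
  open import Data.Nat
  open import Data.Nat.Properties
  open import Data.Nat.Tactic.RingSolver using (solve-∀)

  ^-distribʳ-* : ∀ m n o → (m * n) ^ o ≡ m ^ o * n ^ o
  ^-distribʳ-* m n zero    = refl
  ^-distribʳ-* m n (suc o) = trans (cong (m * n *_) (^-distribʳ-* m n o)) (shuffle m n (m ^ o) (n ^ o))
    where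
    shuffle : ∀ m n x y → m * n * (x * y) ≡ m * x * (n * y)
    shuffle = solve-∀

  fourth : ℕ → ℕ
  fourth m = (m * m) * (m * m)

  fourth-mono : ∀ {m n} → m ≤ n → fourth m ≤ fourth n
  fourth-mono m≤n = *-mono-≤ (*-mono-≤ m≤n m≤n) (*-mono-≤ m≤n m≤n)

  fourth-* : ∀ m n → fourth (m * n) ≡ fourth m * fourth n
  fourth-* = expand
    where
    expand : ∀ m n → (m * n * (m * n)) * (m * n * (m * n)) ≡ (m * m * (m * m)) * (n * n * (n * n))
    expand = solve-∀

  fourth-^ : ∀ b d → fourth (b ^ d) ≡ fourth b ^ d
  fourth-^ b d = sym (trans (^-distribʳ-* (b * b) (b * b) d) (cong₂ _*_ (^-distribʳ-* b b d) (^-distribʳ-* b b d)))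

  ^-split : ∀ b j d → b ^ (j + d * 4) ≡ b ^ j * fourth b ^ d
  ^-split b j d = trans (^-distribˡ-+-* b j (d * 4)) (cong (b ^ j *_)
    (trans (cong (b ^_) (*-comm d 4)) (trans (sym (^-*-assoc b 4 d)) (cong (_^ d) (four b)))))
    where
    four : ∀ b → b * (b * (b * (b * 1))) ≡ (b * b) * (b * b)
    four = solve-∀

  -- B / A is at least 5/4, and once (5/4)^d₀ exceeds K, so does every later power.
  geometric : ∀ K {A B} d₀ {d} .{{_ : NonZero A}} → 5 * A ≤ 4 * B → K * 4 ^ d₀ < 5 ^ d₀ → d₀ ≤ d → K * A ^ d < B ^ d
  geometric K {A} {B} d₀ {d} ratio base d₀≤d = *-cancelˡ-< (4 ^ d) _ _ (begin-strict
    4 ^ d * (K * A ^ d)      ≡⟨ rotate (4 ^ d) K (A ^ d) ⟩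
    (K * 4 ^ d) * A ^ d      <⟨ *-monoˡ-< (A ^ d) {{m^n≢0 A d}} (subst (λ d → K * 4 ^ d < 5 ^ d) (m+[n∸m]≡n d₀≤d) (grow (d ∸ d₀))) ⟩
    5 ^ d * A ^ d            ≡⟨ ^-distribʳ-* 5 A d ⟨
    (5 * A) ^ d              ≤⟨ ^-monoˡ-≤ d ratio ⟩
    (4 * B) ^ d              ≡⟨ ^-distribʳ-* 4 B d ⟩
    4 ^ d * B ^ d            ∎)
    where
    open ≤-Reasoning
    rotate : ∀ x y z → x * (y * z) ≡ (y * x) * z
    rotate = solve-∀
    grow : ∀ k → K * 4 ^ (d₀ + k) < 5 ^ (d₀ + k)
    grow zero    = subst (λ d → K * 4 ^ d < 5 ^ d) (sym (+-identityʳ d₀)) base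
    grow (suc k) = subst (λ d → K * 4 ^ d < 5 ^ d) (sym (+-suc d₀ k)) (begin-strict
      K * (4 * 4 ^ (d₀ + k))   ≡⟨ swap K 4 (4 ^ (d₀ + k)) ⟩
      4 * (K * 4 ^ (d₀ + k))   <⟨ *-monoʳ-< 4 (grow k) ⟩
      4 * 5 ^ (d₀ + k)         ≤⟨ *-monoˡ-≤ (5 ^ (d₀ + k)) (n≤1+n 4) ⟩
      5 * 5 ^ (d₀ + k)         ∎)
      where
      swap : ∀ x y z → x * (y * z) ≡ y * (x * z)
      swap = solve-∀

  module _ (C N d j : ℕ) (N≡j+d*4 : N ≡ j + d * 4) (j≤3 : j ≤ 3)
    (moment : fourth C * 2 ^ d ≤ 16 * (2 ^ N * (2 ^ N * (2 ^ N * (2 ^ d * monomials< N d) + 2 ^ N * 2 ^ N)))) where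

    private
      n = 2 ^ N
      t = 3 ^ N
      -- 96 = 16 · 6: each block of four coordinates gives 2⁴ from 2^N, and 2^d 3^d gives 6.
      y = 96 ^ d

      split : ∀ b → b ^ N ≡ b ^ j * fourth b ^ d
      split b = trans (cong (b ^_) N≡j+d*4) (^-split b j d)

    ndw≤ : n * (2 ^ d * 3 ^ d) ≤ 8 * y
    ndw≤ = begin
      n * (2 ^ d * 3 ^ d)              ≡⟨ cong₂ _*_ (split 2) (sym (^-distribʳ-* 2 3 d)) ⟩
      2 ^ j * 16 ^ d * 6 ^ d           ≡⟨ *-assoc (2 ^ j) (16 ^ d) (6 ^ d) ⟩
      2 ^ j * (16 ^ d * 6 ^ d)         ≡⟨ cong (2 ^ j *_) (^-distribʳ-* 16 6 d) ⟨
      2 ^ j * y                        ≤⟨ *-monoˡ-≤ y (^-monoʳ-≤ 2 j≤3) ⟩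
      8 * y                            ∎
      where open ≤-Reasoning

    -- The kernel term decays like (1/2)^d = (81/162)^d. As 81 ≤ 96, it is absorbed into the term of
    -- the exceptional rows; 27 = 3³ pays for the j ≤ 3 leftover coordinates.
    t≤ : t ≤ 27 * y
    t≤ = begin
      t                  ≡⟨ split 3 ⟩
      3 ^ j * 81 ^ d     ≤⟨ *-mono-≤ (^-monoʳ-≤ 3 j≤3) (^-monoˡ-≤ d (m≤m+n 81 15)) ⟩
      27 * y             ∎
      where open ≤-Reasoning

    ≤3t : 81 ^ d ≤ 3 * t
    ≤3t = begin
      81 ^ d             ≤⟨ m≤n*m (81 ^ d) (3 ^ j) {{m^n≢0 3 j}} ⟩
      3 ^ j * 81 ^ d     ≡⟨ split 3 ⟨
      t                  ≤⟨ m≤n*m t 3 ⟩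
      3 * t              ∎
      where open ≤-Reasoning

    -- Multiplying by 81^d ≤ 3 · 3^N prepares the use of `monomials<-bound`; with the factor 2^d of
    -- the moment it makes 162^d on the left. The constant is 1424 = 16 (8 + 3 · 27).
    fourth-bound : fourth C * 162 ^ d ≤ 1424 * (fourth n * y)
    fourth-bound = begin
      fourth C * 162 ^ d
        ≡⟨ cong (fourth C *_) (^-distribʳ-* 2 81 d) ⟩
      fourth C * (2 ^ d * 81 ^ d)
        ≤⟨ *-monoʳ-≤ (fourth C) (*-monoʳ-≤ (2 ^ d) ≤3t) ⟩
      fourth C * (2 ^ d * (3 * t))
        ≡⟨ *-assoc (fourth C) (2 ^ d) (3 * t) ⟨
      fourth C * 2 ^ d * (3 * t)
        ≤⟨ *-monoˡ-≤ (3 * t) moment ⟩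
      16 * (n * (n * (n * (2 ^ d * monomials< N d) + n * n))) * (3 * t)
        ≡⟨ expand n (2 ^ d) (monomials< N d) t ⟩
      16 * (n * n) * (n * 2 ^ d * (monomials< N d * 3 * t) + n * n * (3 * t))
        ≤⟨ *-monoʳ-≤ (16 * (n * n)) (+-monoˡ-≤ (n * n * (3 * t)) (*-monoʳ-≤ (n * 2 ^ d) (monomials<-bound N d))) ⟩
      16 * (n * n) * (n * 2 ^ d * (3 ^ d * 4 ^ N) + n * n * (3 * t))
        ≡⟨ cong (λ f → 16 * (n * n) * (n * 2 ^ d * (3 ^ d * f) + n * n * (3 * t))) (^-distribʳ-* 2 2 N) ⟩
      16 * (n * n) * (n * 2 ^ d * (3 ^ d * (n * n)) + n * n * (3 * t))
        ≡⟨ factor n (2 ^ d) (3 ^ d) t ⟩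
      16 * fourth n * (n * (2 ^ d * 3 ^ d) + 3 * t)
        ≤⟨ *-monoʳ-≤ (16 * fourth n) (+-mono-≤ ndw≤ (*-monoʳ-≤ 3 t≤)) ⟩
      16 * fourth n * (8 * y + 3 * (27 * y))
        ≡⟨ collect (fourth n) y ⟩
      1424 * (fourth n * y) ∎
      where
      open ≤-Reasoning
      expand : ∀ n D L t → 16 * (n * (n * (n * (D * L) + n * n))) * (3 * t) ≡
        16 * (n * n) * (n * D * (L * 3 * t) + n * n * (3 * t))
      expand = solve-∀
      factor : ∀ n D w t → 16 * (n * n) * (n * D * (w * (n * n)) + n * n * (3 * t)) ≡
        16 * ((n * n) * (n * n)) * (n * (D * w) + 3 * t)
      factor = solve-∀
      collect : ∀ f y → 16 * f * (8 * y + 3 * (27 * y)) ≡ 1424 * (f * y)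
      collect = solve-∀

    module _ (p q d₀ : ℕ) .{{_ : NonZero p}} .{{_ : NonZero q}}
      (ratio : 5 * (96 * fourth (fourth q)) ≤ 4 * (162 * fourth (fourth p)))
      (base : 1424 * fourth (q ^ 3) * 4 ^ d₀ < 5 ^ d₀) (d₀≤d : d₀ ≤ d) where

      fourth≢0 : ∀ m .{{_ : NonZero m}} → NonZero (fourth m)
      fourth≢0 m = m*n≢0 (m * m) (m * m) {{m*n≢0 m m}} {{m*n≢0 m m}}

      -- If it failed, fourth powers would contradict `geometric`. Each block of four coordinates
      -- contributes p¹⁶ to (p^N)⁴ and q¹⁶ to (q^N)⁴; the j ≤ 3 leftover coordinates contribute at
      -- least 1 to the former and at most (q³)⁴ to the latter.
      exponential-bound : C * q ^ N < n * p ^ N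
      exponential-bound = ≰⇒> λ np≤Cq → <⇒≱
        (geometric (1424 * fourth (q ^ 3)) d₀ {{m*n≢0 96 _ {{_}} {{fourth≢0 (fourth q) {{fourth≢0 q}}}}}} ratio base d₀≤d)
        (*-cancelˡ-≤ (fourth n) {{fourth≢0 n {{m^n≢0 2 N}}}} (begin
          fourth n * (162 * fourth (fourth p)) ^ d
            ≡⟨ cong (fourth n *_) (^-distribʳ-* 162 (fourth (fourth p)) d) ⟩
          fourth n * (162 ^ d * fourth (fourth p) ^ d)
            ≤⟨ *-monoʳ-≤ (fourth n) (*-monoʳ-≤ (162 ^ d) p-bound) ⟩
          fourth n * (162 ^ d * fourth (p ^ N))
            ≡⟨ rotate (fourth n) (162 ^ d) (fourth (p ^ N)) ⟩
          (fourth n * fourth (p ^ N)) * 162 ^ d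
            ≡⟨ cong (_* 162 ^ d) (fourth-* n (p ^ N)) ⟨
          fourth (n * p ^ N) * 162 ^ d
            ≤⟨ *-monoˡ-≤ (162 ^ d) (fourth-mono np≤Cq) ⟩
          fourth (C * q ^ N) * 162 ^ d
            ≡⟨ cong (_* 162 ^ d) (fourth-* C (q ^ N)) ⟩
          fourth C * fourth (q ^ N) * 162 ^ d
            ≡⟨ swap (fourth C) (fourth (q ^ N)) (162 ^ d) ⟩
          fourth C * 162 ^ d * fourth (q ^ N)
            ≤⟨ *-mono-≤ fourth-bound q-bound ⟩
          1424 * (fourth n * y) * (fourth (q ^ 3) * fourth (fourth q) ^ d)
            ≡⟨ regroup (fourth n) y (fourth (q ^ 3)) (fourth (fourth q) ^ d) ⟩
          fourth n * (1424 * fourth (q ^ 3) * (y * fourth (fourth q) ^ d))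
            ≡⟨ cong (λ z → fourth n * (1424 * fourth (q ^ 3) * z)) (^-distribʳ-* 96 (fourth (fourth q)) d) ⟨
          fourth n * (1424 * fourth (q ^ 3) * (96 * fourth (fourth q)) ^ d) ∎))
        where
        open ≤-Reasoning
        rotate : ∀ a b c → a * (b * c) ≡ (a * c) * b
        rotate = solve-∀
        swap : ∀ a b c → a * b * c ≡ a * c * b
        swap = solve-∀
        regroup : ∀ f y q r → 1424 * (f * y) * (q * r) ≡ f * (1424 * q * (y * r))
        regroup = solve-∀
        p-bound : fourth (fourth p) ^ d ≤ fourth (p ^ N)
        p-bound = begin
          fourth (fourth p) ^ d                    ≡⟨ fourth-^ (fourth p) d ⟨
          fourth (fourth p ^ d)                    ≤⟨ fourth-mono (m≤n*m (fourth p ^ d) (p ^ j) {{m^n≢0 p j}}) ⟩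
          fourth (p ^ j * fourth p ^ d)            ≡⟨ cong fourth (split p) ⟨
          fourth (p ^ N)                           ∎
        q-bound : fourth (q ^ N) ≤ fourth (q ^ 3) * fourth (fourth q) ^ d
        q-bound = begin
          fourth (q ^ N)                           ≡⟨ cong fourth (split q) ⟩
          fourth (q ^ j * fourth q ^ d)            ≡⟨ fourth-* (q ^ j) (fourth q ^ d) ⟩
          fourth (q ^ j) * fourth (fourth q ^ d)   ≤⟨ *-mono-≤ (fourth-mono (^-monoʳ-≤ q j≤3)) (≤-reflexive (fourth-^ (fourth q) d)) ⟩
          fourth (q ^ 3) * fourth (fourth q) ^ d   ∎

open Numerics

-- Assembly for a cubic polynomial

module Conclusion {N : ℕ} (g : Poly N) (cubic : DegreeAtMost 3 g) (d : ℕ) where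
  open import Data.Integer using (ℤ; +_; -[1+_]; _*_; _≤_; ∣_∣; drop‿+≤+)
  open import Data.Integer.Properties
  open import Data.Integer.Tactic.RingSolver using (solve-∀)

  open Polarization (evalPoly g) (IsDeg-evalPoly g cubic)
  open KernelCount Φ Φ-additive₁ Φ-additive₂ Φ-swapʳ Φ-diagonal d

  balanced : ∀ h k → W h k ≡ false → ∃[ a ] (∀ x → phase (evalPoly g) h k (x ⊕ a) ≡ not (phase (evalPoly g) h k x))
  balanced h k eq with W≡false⇒ h k eq
  ... | a , Φ≡true = e a , λ x → trans (phase-⊕ h k (e a) x)
    (trans (cong (phase (evalPoly g) h k x xor_) Φ≡true) (xor-comm (phase (evalPoly g) h k x) true))

  open FourthMoment (evalPoly g) W balanced

  ∣corrSum∣-moment : fourth ∣ corrSum S4 (evalPoly g) ∣ ℕ.* 2 ℕ.^ d ℕ.≤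
    16 ℕ.* (2 ℕ.^ N ℕ.* (2 ℕ.^ N ℕ.* (2 ℕ.^ N ℕ.* (2 ℕ.^ d ℕ.* monomials< N d) ℕ.+ 2 ℕ.^ N ℕ.* 2 ℕ.^ N)))
  ∣corrSum∣-moment = drop‿+≤+ (begin
    + (fourth ∣ c ∣ ℕ.* 2 ℕ.^ d)                 ≡⟨ pos-* (fourth ∣ c ∣) (2 ℕ.^ d) ⟩
    + fourth ∣ c ∣ * 2^ d                        ≡⟨ cong (_* 2^ d) fourth-∣∣ ⟩
    (c * c) * (c * c) * 2^ d                     ≤⟨ *-monoʳ-≤-nonNeg (2^ d) fourthMoment ⟩
    + 16 * (2^ N * (2^ N * #W)) * 2^ d           ≡⟨ rotate (2^ N) #W (2^ d) ⟩
    + 16 * (2^ N * (2^ N * (2^ d * #W)))         ≤⟨ *-monoˡ-≤-nonNeg (+ 16) (*-monoˡ-≤-nonNeg (2^ N) (*-monoˡ-≤-nonNeg (2^ N) #W-bound)) ⟩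
    + 16 * (2^ N * (2^ N * + r))                 ≡⟨ cong (λ z → + 16 * (2^ N * z)) (pos-* (2 ℕ.^ N) r) ⟨
    + 16 * (2^ N * + (2 ℕ.^ N ℕ.* r))            ≡⟨ cong (+ 16 *_) (pos-* (2 ℕ.^ N) (2 ℕ.^ N ℕ.* r)) ⟨
    + 16 * + (2 ℕ.^ N ℕ.* (2 ℕ.^ N ℕ.* r))       ≡⟨ pos-* 16 (2 ℕ.^ N ℕ.* (2 ℕ.^ N ℕ.* r)) ⟨
    + (16 ℕ.* (2 ℕ.^ N ℕ.* (2 ℕ.^ N ℕ.* r)))     ∎)
    where
    open ≤-Reasoning
    c = corrSum S4 (evalPoly g)
    r = 2 ℕ.^ N ℕ.* (2 ℕ.^ d ℕ.* monomials< N d) ℕ.+ 2 ℕ.^ N ℕ.* 2 ℕ.^ N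
    square : ∀ i → + (∣ i ∣ ℕ.* ∣ i ∣) ≡ i * i
    square (+ n)    = pos-* n n
    square -[1+ n ] = refl
    fourth-∣∣ : + fourth ∣ c ∣ ≡ (c * c) * (c * c)
    fourth-∣∣ = trans (pos-* (∣ c ∣ ℕ.* ∣ c ∣) (∣ c ∣ ℕ.* ∣ c ∣)) (cong₂ _*_ (square c) (square c))
    rotate : ∀ n w d → + 16 * (n * (n * w)) * d ≡ + 16 * (n * (n * (d * w)))
    rotate = solve-∀

open import Data.Nat using (_≤_; _<_; _*_; _^_)
open import Data.Integer using (∣_∣)

-- (63 / 64)¹⁶ > 16 / 27 · 5 / 4, where 16 / 27 = 96 / 162 is the decay rate of the fourth moment per
-- four coordinates; 5 / 4 is then raised to the power 260 to absorb the constants.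
theorem1p3 : ∃[ p ] ∃[ q ] (p < q × ∃[ N₀ ] ((N : ℕ) → N₀ ≤ N → (g : Poly N) → DegreeAtMost 3 g →
    ∣ corrSum S4 (evalPoly g) ∣ * q ^ N < 2 ^ N * p ^ N))
theorem1p3 = 63 , 64 , ℕₚ.≤-refl , 260 * 4 , λ N N₀≤N g cubic →
  exponential-bound ∣ corrSum S4 (evalPoly g) ∣ N (N ℕ./ 4) (N ℕ.% 4) (ℕ.m≡m%n+[m/n]*n N 4) (ℕ.s≤s⁻¹ (ℕ.m%n<n N 4))
    (Conclusion.∣corrSum∣-moment g cubic (N ℕ./ 4))
    63 64 260 (ℕₚ.≤ᵇ⇒≤ _ _ tt) (ℕₚ.<ᵇ⇒< _ _ tt) (260≤N/4 N N₀≤N)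
  where
  260≤N/4 : ∀ N → 260 * 4 ≤ N → 260 ≤ N ℕ./ 4
  260≤N/4 N le = ℕₚ.≤-trans (ℕₚ.≤-reflexive (sym (ℕ.m*n/n≡m 260 4))) (ℕ./-monoˡ-≤ 4 le)
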